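{- For every integer $n\ge0$, the inverse Kazhdan--Lusztig polynomial of the thagomizer matroid $T_n$ is $$Q_{T_n}(t)=\sum_{k=0}^{\lfloor n/2\rfloor}\ \sum_{i=2k}^{n}\frac{n-i+1}{n+1}\binom{n+1}{k,\ i-2k,\ n+k-i+1}t^k ,$$ where $\binom{n+1}{a,b,c}=\frac{(n+1)!}{a!\,b!\,c!}$ is a multinomial coefficient.
   Context: The thagomizer matroid $T_n$ is the graphic matroid of $K_{1,1,n}$ (vertices $A,B,1,\dots,n$, edges $AB,Aj,Bj$ for $1\le j\le n$). For a loopless matroid $\mathrm M$ with lattice of flats $\mathcal L(\mathrm M)$, characteristic polynomial $\chi_{\mathrm M}(t)$, restriction $\mathrm M|_F$ and contraction $\mathrm M/F$, the inverse Kazhdan--Lusztig polynomial $Q_{\mathrm M}(t)\in\mathbb Z[t]$ is the unique polynomial with: $Q_{\mathrm M}=1$ if $\operatorname{rk}\mathrm M=0$; $\deg Q_{\mathrm M}<\tfrac12\operatorname{rk}\mathrm M$ if $\operatorname{rk}\mathrm M>0$; and $t^{\operatorname{rk}\mathrm M}(-1)^{\operatorname{rk}\mathrm M}Q_{\mathrm M}(t^{ -1})=\sum_{F\in\mathcal L(\mathrm M)}(-1)^{\operatorname{rk}\mathrm M|_F}Q_{\mathrm M|_F}(t)\,t^{\operatorname{rk}\mathrm M/F}\chi_{\mathrm M/F}(t^{ -1})$. -}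

module Defs where

open import Data.Bool using (Bool; true; false; _∧_; _∨_; not; if_then_else_)
open import Data.Nat as ℕ using (ℕ; zero; suc; _∸_; _≡ᵇ_; _<ᵇ_; _!; _≤ᵇ_)
open import Data.Nat.Properties using (_!≢0; m*n≢0)
open import Data.Integer as ℤ using (ℤ; +_; -_; 0ℤ; 1ℤ)
open import Data.Rational as ℚ using (ℚ)
open import Data.Fin as Fin using (Fin; zero; suc; toℕ; splitAt)
open import Data.Vec using (Vec; []; _∷_; zipWith; lookup; tabulate; map; foldr)
open import Data.List as List using (List; []; _∷_; _++_; filter; allFin)
open import Data.Sum using (inj₁; inj₂)
open import Data.Product using (_×_; _,_)
open import Relation.Nullary.Decidable using (does)
open import Data.Bool.Properties using (T?)

-- Polynomials with integer coefficients, as coefficient functions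
-- (p k = coefficient of t^k).  All polynomials below have finite support.

Poly : Set
Poly = ℕ → ℤ

0P : Poly
0P _ = 0ℤ

1P : Poly
1P zero = 1ℤ
1P (suc _) = 0ℤ

mono : ℤ → ℕ → Poly
mono c d k = if d ≡ᵇ k then c else 0ℤ

_⊕_ : Poly → Poly → Poly
(p ⊕ q) k = p k ℤ.+ q k

scaleP : ℤ → Poly → Poly
scaleP c p k = c ℤ.* p k

sumTo : ℕ → (ℕ → ℤ) → ℤ
sumTo zero f = f zero
sumTo (suc k) f = sumTo k f ℤ.+ f (suc k)

_⊛_ : Poly → Poly → Poly
(p ⊛ q) k = sumTo k (λ i → p i ℤ.* q (k ∸ i))

sumP : {A : Set} → List A → (A → Poly) → Poly
sumP [] f = 0P
sumP (x ∷ xs) f = f x ⊕ sumP xs f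

-- t^r · p(t⁻¹)  (used only for polynomials p of degree ≤ r)
revP : ℕ → Poly → Poly
revP r p k = if k ≤ᵇ r then p (r ∸ k) else 0ℤ

sign : ℕ → ℤ
sign zero = 1ℤ
sign (suc n) = - sign n

SubsetF : ℕ → Set
SubsetF m = Vec Bool m

allSubsets : (m : ℕ) → List (SubsetF m)
allSubsets zero = [] ∷ []
allSubsets (suc m) =
  List.map (false ∷_) (allSubsets m) ++ List.map (true ∷_) (allSubsets m)

_∪ₛ_ : ∀ {m} → SubsetF m → SubsetF m → SubsetF m
_∪ₛ_ = zipWith _∨_

_∖ₛ_ : ∀ {m} → SubsetF m → SubsetF m → SubsetF m
_∖ₛ_ = zipWith (λ a b → a ∧ not b)

_⊆ᵇ_ : ∀ {m} → SubsetF m → SubsetF m → Bool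
S ⊆ᵇ T = foldr _ _∧_ true (zipWith (λ a b → not a ∨ b) S T)

_==ₛ_ : ∀ {m} → SubsetF m → SubsetF m → Bool
S ==ₛ T = (S ⊆ᵇ T) ∧ (T ⊆ᵇ S)

single : ∀ {m} → Fin m → SubsetF m
single i = tabulate (λ j → does (i Fin.≟ j))

card : ∀ {m} → SubsetF m → ℕ
card = foldr _ (λ b n → if b then suc n else n) 0

-- Matroids on a ground set E ⊆ Fin m, given by a rank function.
-- (Only the values of rk on subsets of E are relevant.)

record Matroid (m : ℕ) : Set where
  constructor mat
  field
    E  : SubsetF m
    rk : SubsetF m → ℕ
open Matroid public

rank : ∀ {m} → Matroid m → ℕ
rank M = rk M (E M)

subsetsOf : ∀ {m} → Matroid m → List (SubsetF m)
subsetsOf {m} M = filter (λ S → T? (S ⊆ᵇ E M)) (allSubsets m)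

isFlat : ∀ {m} → Matroid m → SubsetF m → Bool
isFlat {m} M F =
  (F ⊆ᵇ E M) ∧
  List.foldr _∧_ true
    (List.map (λ e → not (lookup (E M) e ∧ not (lookup F e))
                      ∨ not (rk M (F ∪ₛ single e) ≡ᵇ rk M F))
              (allFin m))

flats : ∀ {m} → Matroid m → List (SubsetF m)
flats {m} M = filter (λ F → T? (isFlat M F)) (allSubsets m)

restrict : ∀ {m} → Matroid m → SubsetF m → Matroid m
restrict M F = mat F (rk M)

contract : ∀ {m} → Matroid m → SubsetF m → Matroid m
contract M F = mat (E M ∖ₛ F) (λ S → rk M (S ∪ₛ F) ∸ rk M F)

charPoly : ∀ {m} → Matroid m → Poly
charPoly M = sumP (subsetsOf M) (λ S → mono (sign (card S)) (rank M ∸ rk M S))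

-- Inverse Kazhdan–Lusztig polynomial.
-- The defining identity
--   t^r (-1)^r Q_M(t⁻¹) = Σ_{F flat} (-1)^{rk F} Q_{M|F}(t) t^{rk M/F} χ_{M/F}(t⁻¹)
-- has the F = E term equal to (-1)^r Q_M(t); since deg Q_M < r/2, comparing
-- coefficients of t^k with 2k < r determines Q_M from the proper flats:
--   [t^k] Q_M = - (-1)^r [t^k] Σ_{F flat, F ≠ E} (...)   for 2k < r,
-- and [t^k] Q_M = 0 otherwise.  The natural-number argument is fuel
-- (proper flats have strictly smaller rank, so fuel rank+1 suffices).

invKLfuel : ℕ → ∀ {m} → Matroid m → Poly
invKLfuel zero M = 1P
invKLfuel (suc f) M with rank M
... | zero = 1P
... | suc r = λ k → if (k ℕ.+ k) <ᵇ suc r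
                      then - (sign (suc r) ℤ.* R k)
                      else 0ℤ
  where
  R : Poly
  R = sumP (filter (λ F → T? (not (F ==ₛ E M))) (flats M)) λ F →
        scaleP (sign (rk M F))
          (invKLfuel f (restrict M F)
            ⊛ revP (rank (contract M F)) (charPoly (contract M F)))

invKL : ∀ {m} → Matroid m → Poly
invKL M = invKLfuel (suc (rank M)) M

-- Graphic matroids: rank of an edge set S = size of a spanning forest of
-- (V, S), computed greedily by merging component labels.

graphicRank : ∀ {v m} → (Fin m → Fin v × Fin v) → SubsetF m → ℕ
graphicRank {v} {m} ends S = go (allFin m) (tabulate toℕ) 0
  where
  go : List (Fin m) → Vec ℕ v → ℕ → ℕ
  go [] lab c = c
  go (e ∷ es) lab c with ends e
  ... | (a , b) =
    if lookup S e ∧ not (lookup lab a ≡ᵇ lookup lab b)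
    then go es (map (λ x → if x ≡ᵇ lookup lab b then lookup lab a else x) lab) (suc c)
    else go es lab c

graphic : ∀ {v m} → (Fin m → Fin v × Fin v) → Matroid m
graphic {m = m} ends = mat (tabulate (λ _ → true)) (graphicRank ends)

-- K_{1,1,n}: vertices A = 0, B = 1, j ↦ 2 + j (j : Fin n);
-- edges: 0 ↦ AB, 1 + j ↦ A j, 1 + n + j ↦ B j.
thagEnds : (n : ℕ) → Fin (suc (n ℕ.+ n)) → Fin (suc (suc n)) × Fin (suc (suc n))
thagEnds n zero = (zero , suc zero)
thagEnds n (suc e) with splitAt n e
... | inj₁ j = (zero , suc (suc j))
... | inj₂ j = (suc zero , suc (suc j))

thagomizer : (n : ℕ) → Matroid (suc (n ℕ.+ n))
thagomizer n = graphic (thagEnds n)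

-- multinomial coefficient (a+b+c)! / (a! b! c!)  with a+b+c = N, in ℚ
multinomial : ℕ → ℕ → ℕ → ℕ → ℚ
multinomial N a b c =
  ℚ._/_ (+ (N !)) ((a ! ℕ.* b !) ℕ.* c !)
    {{m*n≢0 _ _ {{m*n≢0 _ _ {{a !≢0}} {{b !≢0}}}} {{c !≢0}}}}

-- Σ_{i=a}^{b} f i  (empty if b < a)
sumℚ : ℕ → ℕ → (ℕ → ℚ) → ℚ
sumℚ a b f = List.foldr ℚ._+_ ℚ.0ℚ (List.map (λ j → f (a ℕ.+ j)) (List.upTo (suc b ∸ a)))

thagCoeff : ℕ → ℕ → ℚ
thagCoeff n k =
  if k ℕ.≤ᵇ ℕ.⌊ n /2⌋
  then sumℚ (2 ℕ.* k) n (λ i →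
         ℚ._*_ (ℚ._/_ (+ (n ∸ i ℕ.+ 1)) (suc n))
               (multinomial (n ℕ.+ 1) k (i ∸ 2 ℕ.* k) (n ℕ.+ k ∸ i ℕ.+ 1)))
  else ℚ.0ℚ

{-# OPTIONS --safe #-}
module Submission where

-- Write q_n for the generating polynomial, by down steps, of the Motzkin
-- prefixes (steps U, F, D, never below height 0) of length n.  The flats of T_n
-- are the copies of T_J for J ⊆ [n], with Boolean contraction, and the forests
-- that avoid AB, with contraction a thagomizer up to parallel elements.  The
-- defining identity of Q therefore reads
--   t^{n+1} q_n(1/t) = Σ_j C(n,j) (t − 1)^{n−j} q_j(t) − (1 − t)(1 + 2t)^n.
-- The binomial transform turns the weight 1 of a flat step into t, and
-- h ↦ 1 − t^{h+1} is an eigenfunction, with eigenvalue 1 + 2t, of the step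
-- operator with weights 1, t, t.  So the right-hand side is the sum over all
-- prefixes of t^{#D + #F + h + 1}, where h is the final height; it has no terms
-- of degree ≤ n/2, while q_n has degree ≤ n/2, and these two facts determine Q.
-- The coefficients of q_n are ballot numbers.

open import Defs
open import Data.Bool using (Bool; true; false; _∧_; _∨_; not; if_then_else_; T)
import Data.Bool.Properties as Boolₚ
open import Data.Nat as ℕ using (ℕ; zero; suc; _∸_; _≡ᵇ_; _≤_; _<_; z≤n; s≤s)
import Data.Nat.Properties as ℕₚ
open import Data.Nat using (_!; NonZero)
open import Data.Nat.Tactic.RingSolver using () renaming (solve-∀ to solveℕ-∀)
open import Data.Integer as ℤ using (ℤ; +_; -[1+_]; 0ℤ; 1ℤ; -1ℤ)
import Data.Integer.Properties as ℤₚ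
open import Data.Integer.Tactic.RingSolver using (solve-∀)
open import Data.Rational as ℚ using (ℚ; _/_)
import Data.Rational.Properties as ℚₚ
open import Data.Rational.Unnormalised as ℚᵘ using (mkℚᵘ; *≡*)
import Data.Rational.Unnormalised.Properties as ℚᵘₚ
open import Data.Fin using (Fin; zero; suc; toℕ; _↑ˡ_; _↑ʳ_; splitAt)
import Data.Fin.Properties as Finₚ
open import Data.Vec as Vec using (Vec; []; _∷_; lookup; tabulate; _++_)
import Data.Vec.Properties as Vecₚ
open import Data.List as List using (List; []; _∷_; allFin)
import Data.List.Properties as Listₚ
open import Data.List.Membership.Propositional using (_∈_; _∉_)
open import Data.List.Membership.Propositional.Properties using (∈-allFin)
open import Data.List.Relation.Unary.Any using (here; there)
open import Data.List.Relation.Unary.All as All using ()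
open import Data.List.Relation.Unary.AllPairs using ([]; _∷_)
open import Data.List.Relation.Unary.Unique.Propositional using (Unique)
open import Data.List.Relation.Unary.Unique.Propositional.Properties using (allFin⁺)
open import Data.Product using (∃; _×_; _,_)
open import Data.Sum using (_⊎_; inj₁; inj₂)
open import Data.Empty using (⊥-elim)
open import Data.Unit using (tt)
open import Function using (_∘_; id)
open import Relation.Nullary using (yes; no; contradiction)
open import Relation.Binary.PropositionalEquality using (_≡_; _≢_; _≗_; refl; sym; trans; cong; cong₂; subst; subst₂; module ≡-Reasoning)

-- Let S = U + 1 + tD be the step operator of the Motzkin prefixes, acting on functions φ of the
-- height, so that q_n = (S^n 1)(0). Multiplication by t commutes with S, so the signed sum over
-- subsets of [n] is the n-th power of (1 - t) - S = -(U + t + tD). This is why the statements about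
-- paths allow an arbitrary end weight φ: 1, 1 - t^{h+1} and their difference are all fed to one
-- operator. Compared with the displayed identity everything carries a further sign (-1)^n, because
-- the signs (-1)^{rk F} are distributed over the vertices j. The recursion for Q descends to
-- restrictions, which keep the rank function of T_n and change only the ground set E. The induction
-- therefore runs over all J ⊆ [n], inside the edge type of the one graph K_{1,1,n}. Sums over flats
-- are evaluated one vertex j at a time, each vertex contributing a polynomial of degree at most 1
-- as a factor.

-- The local function of graphicRank has no name; abstracting the three
-- arguments of its call lets unification name it.
mutual
  greedy : ∀ {v m} → (Fin m → Fin v × Fin v) → SubsetF m → List (Fin m) → Vec ℕ v → ℕ → ℕ
  greedy = _

  graphicRank≡greedy : ∀ {v m} (ends : Fin m → Fin v × Fin v) (S : SubsetF m) →
    graphicRank ends S ≡ greedy ends S (allFin m) (tabulate toℕ) 0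
  graphicRank≡greedy {v} {m} ends S with allFin m | tabulate {n = v} toℕ | 0
  ... | es | lab | c = refl

relabel : ∀ {v} → ℕ → ℕ → Vec ℕ v → Vec ℕ v
relabel old new = Vec.map (λ x → if x ≡ᵇ old then new else x)

greedy-cons : ∀ {v m} (ends : Fin m → Fin v × Fin v) (S : SubsetF m) e es lab c {a b s la lb} →
  ends e ≡ (a , b) → lookup S e ≡ s → lookup lab a ≡ la → lookup lab b ≡ lb →
  greedy ends S (e ∷ es) lab c ≡
    (if s ∧ not (la ≡ᵇ lb)
     then greedy ends S es (relabel lb la lab) (suc c)
     else greedy ends S es lab c)
greedy-cons ends S e es lab c eq refl refl refl with ends e | eq
... | _ | refl = refl

-- The greedy rank of an edge set of K_{1,1,n}.

bit : Bool → ℕ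
bit b = if b then 1 else 0

bit-≡ᵇ-refl : ∀ p → (bit p ≡ᵇ bit p) ≡ true
bit-≡ᵇ-refl false = refl
bit-≡ᵇ-refl true = refl

bit-≡ᵇ-≢ : ∀ {p q} → p ≢ q → (bit p ≡ᵇ bit q) ≡ false
bit-≡ᵇ-≢ {false} {false} p≢q = contradiction refl p≢q
bit-≡ᵇ-≢ {false} {true} p≢q = refl
bit-≡ᵇ-≢ {true} {false} p≢q = refl
bit-≡ᵇ-≢ {true} {true} p≢q = contradiction refl p≢q

bit-≡ᵇ-vertex : ∀ p v → (bit p ≡ᵇ suc (suc v)) ≡ false
bit-≡ᵇ-vertex false v = refl
bit-≡ᵇ-vertex true v = refl

vertex-≡ᵇ-bit : ∀ p v → (suc (suc v) ≡ᵇ bit p) ≡ false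
vertex-≡ᵇ-bit false v = refl
vertex-≡ᵇ-bit true v = refl

≡ᵇ-refl : ∀ m → (m ≡ᵇ m) ≡ true
≡ᵇ-refl zero = refl
≡ᵇ-refl (suc m) = ≡ᵇ-refl m

≢⇒≡ᵇ-false : ∀ m n → m ≢ n → (m ≡ᵇ n) ≡ false
≢⇒≡ᵇ-false zero zero m≢n = contradiction refl m≢n
≢⇒≡ᵇ-false zero (suc n) m≢n = refl
≢⇒≡ᵇ-false (suc m) zero m≢n = refl
≢⇒≡ᵇ-false (suc m) (suc n) m≢n = ≢⇒≡ᵇ-false m n (m≢n ∘ cong suc)

lookup-relabel : ∀ {v} old new (lab : Vec ℕ v) i {l} → lookup lab i ≡ l →
  lookup (relabel old new lab) i ≡ (if l ≡ᵇ old then new else l)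
lookup-relabel old new lab i refl = Vecₚ.lookup-map i _ lab

tabulate-+ : ∀ {A : Set} m n (f : Fin (m ℕ.+ n) → A) →
  List.tabulate f ≡ List.tabulate (f ∘ (_↑ˡ n)) List.++ List.tabulate (f ∘ (m ↑ʳ_))
tabulate-+ zero n f = refl
tabulate-+ (suc m) n f = cong (f zero ∷_) (tabulate-+ m n (f ∘ suc))

-- An edge set of K_{1,1,n}: b tells whether AB is in it, x_j and y_j whether
-- Aj and Bj are.
edges : ∀ {n} → Bool → Vec Bool n → Vec Bool n → SubsetF (suc (n ℕ.+ n))
edges b x y = b ∷ (x ++ y)

conn : ∀ {n} → Vec Bool n → Vec Bool n → Bool
conn [] [] = false
conn (a ∷ x) (b ∷ y) = (a ∧ b) ∨ conn x y

cov : ∀ {n} → Vec Bool n → Vec Bool n → ℕ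
cov [] [] = 0
cov (a ∷ x) (b ∷ y) = bit (a ∨ b) ℕ.+ cov x y

module _ {n : ℕ} (b : Bool) (x y : Vec Bool n) where

  private
    S = edges b x y

    eA eB : Fin n → Fin (suc (n ℕ.+ n))
    eA j = suc (j ↑ˡ n)
    eB j = suc (n ↑ʳ j)

    vertex : Fin n → Fin (suc (suc n))
    vertex j = suc (suc j)

    run : List (Fin (suc (n ℕ.+ n))) → Vec ℕ (suc (suc n)) → ℕ → ℕ
    run = greedy (thagEnds n) S

    ends-A : ∀ j → thagEnds n (eA j) ≡ (zero , vertex j)
    ends-A j rewrite Finₚ.splitAt-↑ˡ n j n = refl

    ends-B : ∀ j → thagEnds n (eB j) ≡ (suc zero , vertex j)
    ends-B j rewrite Finₚ.splitAt-↑ʳ n n j = refl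

  connAt : List (Fin n) → Bool
  connAt [] = false
  connAt (j ∷ js) = (lookup x j ∧ lookup y j) ∨ connAt js

  -- The edges Aj are processed before the edges Bj. Every Aj present is therefore the one that
  -- covers j, and Bj covers j only if Aj is absent; this splits `cov` into `countA` and `onlyB`.
  onlyB : List (Fin n) → ℕ
  onlyB [] = 0
  onlyB (j ∷ js) = bit (not (lookup x j) ∧ lookup y j) ℕ.+ onlyB js

  countA : List (Fin n) → ℕ
  countA [] = 0
  countA (j ∷ js) = bit (lookup x j) ℕ.+ countA js

  -- Once the edges Aj have been processed, the labels of A and B are the bits
  -- p and q, and j carries the label of A or its initial label.
  labelOf : Bool → Fin n → ℕ
  labelOf p j = if lookup x j then bit p else suc (suc (toℕ j))

  -- An edge Bj with Aj absent always merges. With Aj present it merges only if A and B are still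
  -- apart, which happens at most once. The bit of p = q records whether A and B are already joined;
  -- adding it on the left makes the count an invariant free of subtraction.
  run-B : ∀ js → Unique js → ∀ p q lab c →
    lookup lab zero ≡ bit p → lookup lab (suc zero) ≡ bit q →
    (∀ j → j ∈ js → lookup lab (vertex j) ≡ labelOf p j) →
    run (List.map eB js) lab c ℕ.+ bit (bit p ≡ᵇ bit q) ≡
      c ℕ.+ (bit ((bit p ≡ᵇ bit q) ∨ connAt js) ℕ.+ onlyB js)
  run-B [] _ p q lab c _ _ _ with bit p ≡ᵇ bit q
  ... | false = refl
  ... | true = refl
  run-B (j ∷ js) (j∉js ∷ uniq) p q lab c hA hB hJ
    with step ← greedy-cons (thagEnds n) S (eB j) (List.map eB js) lab c
                  (ends-B j) (Vecₚ.lookup-++ʳ x y j) hB (hJ j (here refl))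
    with IH ← run-B js uniq
    with lookup x j in xj | lookup y j in yj
  ... | false | false rewrite step = IH p q lab c hA hB (λ i i∈ → hJ i (there i∈))
  ... | true | false rewrite step = IH p q lab c hA hB (λ i i∈ → hJ i (there i∈))
  ... | false | true rewrite step | bit-≡ᵇ-vertex q (toℕ j) =
    trans (IH p q lab′ (suc c) hA′ hB′ hJ′)
      (trans (sym (ℕₚ.+-suc c _)) (cong (c ℕ.+_) (sym (ℕₚ.+-suc (bit ((bit p ≡ᵇ bit q) ∨ connAt js)) _))))
    where
    old = suc (suc (toℕ j))
    lab′ = relabel old (bit q) lab
    hA′ : lookup lab′ zero ≡ bit p
    hA′ = trans (lookup-relabel old (bit q) lab zero hA)
                (cong (λ d → if d then bit q else bit p) (bit-≡ᵇ-vertex p (toℕ j)))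
    hB′ : lookup lab′ (suc zero) ≡ bit q
    hB′ = trans (lookup-relabel old (bit q) lab (suc zero) hB)
                (cong (λ d → if d then bit q else bit q) (bit-≡ᵇ-vertex q (toℕ j)))
    keep : ∀ i → i ∈ js → (labelOf p i ≡ᵇ old) ≡ false
    keep i i∈ with lookup x i
    ... | true = bit-≡ᵇ-vertex p (toℕ j)
    ... | false = ≢⇒≡ᵇ-false (toℕ i) (toℕ j)
                    (λ eq → All.lookup j∉js i∈ (sym (Finₚ.toℕ-injective eq)))
    hJ′ : ∀ i → i ∈ js → lookup lab′ (vertex i) ≡ labelOf p i
    hJ′ i i∈ = trans (lookup-relabel old (bit q) lab (vertex i) (hJ i (there i∈)))
                     (cong (λ d → if d then bit q else labelOf p i) (keep i i∈))
  ... | true | true with p Boolₚ.≟ q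
  ...   | yes refl rewrite step | bit-≡ᵇ-refl p =
    trans (cong (run (List.map eB js) lab c ℕ.+_) (cong bit (sym (bit-≡ᵇ-refl p))))
      (trans (IH p p lab c hA hB (λ i i∈ → hJ i (there i∈)))
        (cong (λ d → c ℕ.+ (bit (d ∨ connAt js) ℕ.+ onlyB js)) (bit-≡ᵇ-refl p)))
  -- Bj keeps the label of B and overwrites that of j, which is the label p of A. The whole
  -- component of A moves to q, and both bits are q from here on.
  ...   | no p≢q rewrite step | bit-≡ᵇ-≢ p≢q | bit-≡ᵇ-≢ (p≢q ∘ sym) =
    trans (ℕₚ.+-identityʳ _)
      (ℕₚ.+-cancelʳ-≡ 1 _ _
        (trans (cong (run (List.map eB js) lab′ (suc c) ℕ.+_) (cong bit (sym (bit-≡ᵇ-refl q))))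
          (trans (IH q q lab′ (suc c) hA′ hB′ hJ′)
            (trans (cong (λ d → suc c ℕ.+ (bit (d ∨ connAt js) ℕ.+ onlyB js)) (bit-≡ᵇ-refl q))
              (ℕₚ.+-comm 1 (c ℕ.+ suc (onlyB js)))))))
    where
    lab′ = relabel (bit p) (bit q) lab
    hA′ : lookup lab′ zero ≡ bit q
    hA′ = trans (lookup-relabel (bit p) (bit q) lab zero hA)
                (cong (λ d → if d then bit q else bit p) (bit-≡ᵇ-refl p))
    hB′ : lookup lab′ (suc zero) ≡ bit q
    hB′ = trans (lookup-relabel (bit p) (bit q) lab (suc zero) hB)
                (cong (λ d → if d then bit q else bit q) (bit-≡ᵇ-≢ (p≢q ∘ sym)))
    moved : ∀ i → (if labelOf p i ≡ᵇ bit p then bit q else labelOf p i) ≡ labelOf q i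
    moved i with lookup x i
    ... | true rewrite bit-≡ᵇ-refl p = refl
    ... | false rewrite vertex-≡ᵇ-bit p (toℕ i) = refl
    hJ′ : ∀ i → i ∈ js → lookup lab′ (vertex i) ≡ labelOf q i
    hJ′ i i∈ = trans (lookup-relabel (bit p) (bit q) lab (vertex i) (hJ i (there i∈))) (moved i)

  -- Each Aj in turn meets a vertex j that still has its initial label, so it merges whenever it is
  -- present, and the label of A stays 0. The bit q is `true` if B still has its own label 1, and
  -- `false` if AB has already joined B to A.
  run-A : ∀ js → Unique js → ∀ q lab c →
    lookup lab zero ≡ 0 → lookup lab (suc zero) ≡ bit q →
    (∀ j → j ∈ js → lookup lab (vertex j) ≡ suc (suc (toℕ j))) →
    (∀ j → j ∉ js → lookup lab (vertex j) ≡ labelOf false j) →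
    run (List.map eA js List.++ List.map eB (allFin n)) lab c ℕ.+ bit (0 ≡ᵇ bit q) ≡
      c ℕ.+ (countA js ℕ.+ (bit ((0 ≡ᵇ bit q) ∨ connAt (allFin n)) ℕ.+ onlyB (allFin n)))
  run-A [] _ q lab c hA hB _ hJ =
    run-B (allFin n) (allFin⁺ n) false q lab c hA hB (λ j _ → hJ j (λ ()))
  run-A (j ∷ js) (j∉js ∷ uniq) q lab c hA hB hI hJ
    with step ← greedy-cons (thagEnds n) S (eA j) (List.map eA js List.++ List.map eB (allFin n)) lab c
                  (ends-A j) (Vecₚ.lookup-++ˡ x y j) hA (hI j (here refl))
    with IH ← run-A js uniq q
    with lookup x j in xj
  ... | false rewrite step = IH lab c hA hB (λ i i∈ → hI i (there i∈)) hJ′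
    where
    hJ′ : ∀ i → i ∉ js → lookup lab (vertex i) ≡ labelOf false i
    hJ′ i i∉ with i Finₚ.≟ j
    ... | no i≢j = hJ i (λ { (here i≡j) → i≢j i≡j ; (there i∈) → i∉ i∈ })
    ... | yes refl rewrite xj = hI i (here refl)
  ... | true rewrite step = trans (IH lab′ (suc c) hA′ hB′ hI′ hJ′) (sym (ℕₚ.+-suc c _))
    where
    old = suc (suc (toℕ j))
    lab′ = relabel old 0 lab
    hA′ : lookup lab′ zero ≡ 0
    hA′ = lookup-relabel old 0 lab zero hA
    hB′ : lookup lab′ (suc zero) ≡ bit q
    hB′ = trans (lookup-relabel old 0 lab (suc zero) hB)
                (cong (λ d → if d then 0 else bit q) (bit-≡ᵇ-vertex q (toℕ j)))
    hI′ : ∀ i → i ∈ js → lookup lab′ (vertex i) ≡ suc (suc (toℕ i))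
    hI′ i i∈ = trans (lookup-relabel old 0 lab (vertex i) (hI i (there i∈)))
      (cong (λ d → if d then 0 else suc (suc (toℕ i)))
        (≢⇒≡ᵇ-false (toℕ i) (toℕ j)
          (λ eq → All.lookup j∉js i∈ (sym (Finₚ.toℕ-injective eq)))))
    hJ′ : ∀ i → i ∉ js → lookup lab′ (vertex i) ≡ labelOf false i
    hJ′ i i∉ with i Finₚ.≟ j
    ... | yes refl rewrite xj =
      trans (lookup-relabel old 0 lab (vertex j) (hI j (here refl)))
            (cong (λ d → if d then 0 else old) (≡ᵇ-refl (toℕ j)))
    ... | no i≢j = trans
      (lookup-relabel old 0 lab (vertex i)
        (hJ i (λ { (here i≡j) → i≢j i≡j ; (there i∈) → i∉ i∈ })))
      (cong (λ d → if d then 0 else labelOf false i) same)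
      where
      same : (labelOf false i ≡ᵇ old) ≡ false
      same with lookup x i
      ... | true = refl
      ... | false = ≢⇒≡ᵇ-false (toℕ i) (toℕ j) (i≢j ∘ Finₚ.toℕ-injective)

  private
    edgeList : allFin (suc (n ℕ.+ n)) ≡
      zero ∷ (List.map eA (allFin n) List.++ List.map eB (allFin n))
    edgeList = cong (zero ∷_) (trans (tabulate-+ n n suc)
      (sym (cong₂ List._++_ (Listₚ.map-tabulate id eA) (Listₚ.map-tabulate id eB))))

    run-AB : ∀ b′ → b ≡ b′ →
      run (zero ∷ (List.map eA (allFin n) List.++ List.map eB (allFin n))) (tabulate toℕ) 0 ≡
        countA (allFin n) ℕ.+ (bit (b′ ∨ connAt (allFin n)) ℕ.+ onlyB (allFin n))
    run-AB b′ eq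
      with step ← greedy-cons (thagEnds n) S zero
                    (List.map eA (allFin n) List.++ List.map eB (allFin n)) (tabulate toℕ) 0
                    refl eq refl refl
      with b′
    ... | false = trans step (trans (sym (ℕₚ.+-identityʳ _))
      (run-A (allFin n) (allFin⁺ n) true (tabulate toℕ) 0 refl refl
        (λ j _ → Vecₚ.lookup∘tabulate toℕ (vertex j))
        (λ j j∉ → contradiction (∈-allFin j) j∉)))
    -- AB has merged A and B, so the count starts at 1, and the bit on the left of the invariant is
    -- 1 as well; the two cancel.
    ... | true = trans step (ℕₚ.+-cancelʳ-≡ 1 _ _ (trans
      (run-A (allFin n) (allFin⁺ n) false (relabel 1 0 (tabulate toℕ)) 1 refl refl
        (λ j _ → lookup-relabel 1 0 (tabulate toℕ) (vertex j) (Vecₚ.lookup∘tabulate toℕ (vertex j)))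
        (λ j j∉ → contradiction (∈-allFin j) j∉))
      (ℕₚ.+-comm 1 _)))

  run-thag : graphicRank (thagEnds n) S ≡
    countA (allFin n) ℕ.+ (bit (b ∨ connAt (allFin n)) ℕ.+ onlyB (allFin n))
  run-thag = trans (graphicRank≡greedy (thagEnds n) S)
    (trans (cong (λ es → run es (tabulate toℕ) 0) edgeList) (run-AB b refl))

connAt-tabulate : ∀ {n m} b (x y : Vec Bool n) (f : Fin m → Fin n) →
  connAt b x y (List.tabulate f) ≡ conn (tabulate (lookup x ∘ f)) (tabulate (lookup y ∘ f))
connAt-tabulate {m = zero} b x y f = refl
connAt-tabulate {m = suc m} b x y f = cong ((lookup x (f zero) ∧ lookup y (f zero)) ∨_) (connAt-tabulate b x y (f ∘ suc))

countA+onlyB-tabulate : ∀ {n m} b (x y : Vec Bool n) (f : Fin m → Fin n) →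
  countA b x y (List.tabulate f) ℕ.+ onlyB b x y (List.tabulate f) ≡
    cov (tabulate (lookup x ∘ f)) (tabulate (lookup y ∘ f))
countA+onlyB-tabulate {m = zero} b x y f = refl
countA+onlyB-tabulate {m = suc m} b x y f
  with IH ← countA+onlyB-tabulate b x y (f ∘ suc)
  with lookup x (f zero) | lookup y (f zero)
... | false | false = IH
... | false | true = trans (ℕₚ.+-suc _ _) (cong suc IH)
... | true | false = cong suc IH
... | true | true = cong suc IH

-- A spanning forest has one edge for each covered vertex j, attaching it to A or B, and one more
-- exactly when A and B lie in the same component.
thagRank : ∀ {n} → Bool → Vec Bool n → Vec Bool n → ℕ
thagRank b x y = bit (b ∨ conn x y) ℕ.+ cov x y

rk-thagomizer : ∀ {n} b (x y : Vec Bool n) → rk (thagomizer n) (edges b x y) ≡ thagRank b x y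
rk-thagomizer {n} b x y = begin
  graphicRank (thagEnds n) (edges b x y)
    ≡⟨ run-thag b x y ⟩
  A ℕ.+ (bit (b ∨ C) ℕ.+ B)
    ≡⟨ sym (ℕₚ.+-assoc A _ B) ⟩
  A ℕ.+ bit (b ∨ C) ℕ.+ B
    ≡⟨ cong (ℕ._+ B) (ℕₚ.+-comm A _) ⟩
  bit (b ∨ C) ℕ.+ A ℕ.+ B
    ≡⟨ ℕₚ.+-assoc (bit (b ∨ C)) A B ⟩
  bit (b ∨ C) ℕ.+ (A ℕ.+ B)
    ≡⟨ cong₂ (λ c d → bit (b ∨ c) ℕ.+ d) (connAt-tabulate b x y id) (countA+onlyB-tabulate b x y id) ⟩
  thagRank b (tabulate (lookup x)) (tabulate (lookup y))
    ≡⟨ cong₂ (thagRank b) (Vecₚ.tabulate∘lookup x) (Vecₚ.tabulate∘lookup y) ⟩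
  thagRank b x y ∎
  where
  open ≡-Reasoning
  A = countA b x y (allFin n)
  B = onlyB b x y (allFin n)
  C = connAt b x y (allFin n)

-- Weighted lattice paths and the polynomial identity.

shift : Poly → Poly
shift p zero = 0ℤ
shift p (suc k) = p k

shift-cong : ∀ {p q : Poly} → p ≗ q → shift p ≗ shift q
shift-cong p≗q zero = refl
shift-cong p≗q (suc k) = p≗q k

shift-lin : ∀ a b (p q : Poly) k →
  shift (λ i → a ℤ.* p i ℤ.+ b ℤ.* q i) k ≡ a ℤ.* shift p k ℤ.+ b ℤ.* shift q k
shift-lin a b p q zero = sym (cong₂ ℤ._+_ (ℤₚ.*-zeroʳ a) (ℤₚ.*-zeroʳ b))
shift-lin a b p q (suc k) = refl

-- The factor t of a down step is built in. The value 0 at height 0 is the wall that keeps the paths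
-- at nonnegative heights.
down : (ℕ → Poly) → ℕ → Poly
down φ zero = 0P
down φ (suc h) = shift (φ h)

down-cong : ∀ {φ ψ : ℕ → Poly} → (∀ h → φ h ≗ ψ h) → ∀ h → down φ h ≗ down ψ h
down-cong φ≗ψ zero k = refl
down-cong φ≗ψ (suc h) = shift-cong (φ≗ψ h)

down-lin : ∀ a b (φ ψ : ℕ → Poly) h k →
  down (λ i j → a ℤ.* φ i j ℤ.+ b ℤ.* ψ i j) h k ≡ a ℤ.* down φ h k ℤ.+ b ℤ.* down ψ h k
down-lin a b φ ψ zero k = sym (cong₂ ℤ._+_ (ℤₚ.*-zeroʳ a) (ℤₚ.*-zeroʳ b))
down-lin a b φ ψ (suc h) k = shift-lin a b (φ h) (ψ h) k

down-shift : ∀ (φ : ℕ → Poly) h k → down (λ i → shift (φ i)) h k ≡ shift (down φ h) k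
down-shift φ zero zero = refl
down-shift φ zero (suc k) = refl
down-shift φ (suc h) k = refl

-- One step of a path: up has weight u, down has weight u t, and flat has
-- weight c + d t.
module Paths (u c d : ℤ) where

  step : (ℕ → Poly) → ℕ → Poly
  step φ h k = u ℤ.* φ (suc h) k ℤ.+ c ℤ.* φ h k ℤ.+ d ℤ.* shift (φ h) k ℤ.+ u ℤ.* down φ h k

  -- `paths n φ h` is the total weight of the paths of length n from height h, an end at height i
  -- being weighted by φ i. The recursion peels off the last step, so that lengthening the paths
  -- only changes φ; the induction in `binT-paths` rests on this.
  paths : ℕ → (ℕ → Poly) → ℕ → Poly
  paths zero φ = φ
  paths (suc n) φ = paths n (step φ)

  step-cong : ∀ {φ ψ : ℕ → Poly} → (∀ h → φ h ≗ ψ h) → ∀ h → step φ h ≗ step ψ h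
  step-cong eq h k = cong₂ ℤ._+_
    (cong₂ ℤ._+_ (cong₂ ℤ._+_ (cong (u ℤ.*_) (eq (suc h) k)) (cong (c ℤ.*_) (eq h k)))
      (cong (d ℤ.*_) (shift-cong (eq h) k)))
    (cong (u ℤ.*_) (down-cong eq h k))

  paths-cong : ∀ n {φ ψ : ℕ → Poly} → (∀ h → φ h ≗ ψ h) → ∀ h → paths n φ h ≗ paths n ψ h
  paths-cong zero eq = eq
  paths-cong (suc n) eq = paths-cong n (step-cong eq)

  step-lin : ∀ a b (φ ψ : ℕ → Poly) h k →
    step (λ i j → a ℤ.* φ i j ℤ.+ b ℤ.* ψ i j) h k ≡ a ℤ.* step φ h k ℤ.+ b ℤ.* step ψ h k
  step-lin a b φ ψ h k rewrite shift-lin a b (φ h) (ψ h) k | down-lin a b φ ψ h k =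
    ring u c d a b (φ (suc h) k) (ψ (suc h) k) (φ h k) (ψ h k)
      (shift (φ h) k) (shift (ψ h) k) (down φ h k) (down ψ h k)
    where
    ring : ∀ u c d a b x x′ y y′ z z′ w w′ →
      u ℤ.* (a ℤ.* x ℤ.+ b ℤ.* x′) ℤ.+ c ℤ.* (a ℤ.* y ℤ.+ b ℤ.* y′)
        ℤ.+ d ℤ.* (a ℤ.* z ℤ.+ b ℤ.* z′) ℤ.+ u ℤ.* (a ℤ.* w ℤ.+ b ℤ.* w′) ≡
      a ℤ.* (u ℤ.* x ℤ.+ c ℤ.* y ℤ.+ d ℤ.* z ℤ.+ u ℤ.* w)
        ℤ.+ b ℤ.* (u ℤ.* x′ ℤ.+ c ℤ.* y′ ℤ.+ d ℤ.* z′ ℤ.+ u ℤ.* w′)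
    ring = solve-∀

  paths-lin : ∀ n a b (φ ψ : ℕ → Poly) h k →
    paths n (λ i j → a ℤ.* φ i j ℤ.+ b ℤ.* ψ i j) h k ≡ a ℤ.* paths n φ h k ℤ.+ b ℤ.* paths n ψ h k
  paths-lin zero a b φ ψ h k = refl
  paths-lin (suc n) a b φ ψ h k =
    trans (paths-cong n (step-lin a b φ ψ) h k) (paths-lin n a b (step φ) (step ψ) h k)

  step-shift : ∀ (φ : ℕ → Poly) h k → step (λ i → shift (φ i)) h k ≡ shift (step φ h) k
  step-shift φ h k rewrite down-shift φ h k with k
  ... | zero = ring u c d
    where
    ring : ∀ u c d → u ℤ.* 0ℤ ℤ.+ c ℤ.* 0ℤ ℤ.+ d ℤ.* 0ℤ ℤ.+ u ℤ.* 0ℤ ≡ 0ℤ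
    ring = solve-∀
  ... | suc k′ = refl

  paths-shift : ∀ n (φ : ℕ → Poly) h k → paths n (λ i → shift (φ i)) h k ≡ shift (paths n φ h) k
  paths-shift zero φ h k = refl
  paths-shift (suc n) φ h k = trans (paths-cong n (step-shift φ) h k) (paths-shift n (step φ) h k)

  step-zero : ∀ {φ : ℕ → Poly} {h k} → φ (suc h) k ≡ 0ℤ → φ h k ≡ 0ℤ → shift (φ h) k ≡ 0ℤ →
    down φ h k ≡ 0ℤ → step φ h k ≡ 0ℤ
  step-zero e₁ e₂ e₃ e₄ rewrite e₁ | e₂ | e₃ | e₄ = ring u c d
    where
    ring : ∀ u c d → u ℤ.* 0ℤ ℤ.+ c ℤ.* 0ℤ ℤ.+ d ℤ.* 0ℤ ℤ.+ u ℤ.* 0ℤ ≡ 0ℤ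
    ring = solve-∀

  -- A path of n steps rises by at most n, so it never reaches the heights where φ can be nonzero.
  paths-high : ∀ n m (φ : ℕ → Poly) → (∀ h k → h < n ℕ.+ m → φ h k ≡ 0ℤ) →
    ∀ h k → h < m → paths n φ h k ≡ 0ℤ
  paths-high zero m φ van = van
  paths-high (suc n) m φ van = paths-high n m (step φ) λ h k h< →
    step-zero {φ} (van (suc h) k (s≤s h<)) (van h k (ℕₚ.m≤n⇒m≤1+n h<))
      (shift-van h k h<) (down-van h k h<)
    where
    shift-van : ∀ h k → h < n ℕ.+ m → shift (φ h) k ≡ 0ℤ
    shift-van h zero h< = refl
    shift-van h (suc k) h< = van h k (ℕₚ.m≤n⇒m≤1+n h<)
    down-van : ∀ h k → h < n ℕ.+ m → down φ h k ≡ 0ℤ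
    down-van zero k h< = refl
    down-van (suc h) k h< = shift-van h k (ℕₚ.≤-trans (ℕₚ.n≤1+n _) h<)

motzkin : ℕ → Poly
motzkin n = Paths.paths 1ℤ 1ℤ 0ℤ n (λ _ → 1P) 0

open Paths using (step; paths)

2*suc : ∀ k → 2 ℕ.* suc k ≡ suc (suc (2 ℕ.* k))
2*suc k = cong suc (ℕₚ.+-suc k (k ℕ.+ 0))

-- The bound 2 deg φ_h ≤ m + h loses at most 1 per step: an up step raises h by 1, a down step costs
-- 2 for its factor t but lowers h by 1, and a flat step has weight 1.
paths-degree : ∀ n m (φ : ℕ → Poly) → (∀ h k → m ℕ.+ h < 2 ℕ.* k → φ h k ≡ 0ℤ) →
  ∀ h k → n ℕ.+ m ℕ.+ h < 2 ℕ.* k → paths 1ℤ 1ℤ 0ℤ n φ h k ≡ 0ℤ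
paths-degree zero m φ van = van
paths-degree (suc n) m φ van h k n< =
  paths-degree n (suc m) (step 1ℤ 1ℤ 0ℤ φ) van′ h k
    (subst (λ z → z ℕ.+ h < 2 ℕ.* k) (sym (ℕₚ.+-suc n m)) n<)
  where
  down-van : ∀ h k → suc (m ℕ.+ h) < 2 ℕ.* k → down φ h k ≡ 0ℤ
  down-van zero k _ = refl
  down-van (suc h) zero ()
  down-van (suc h) (suc k) lt = van h k
    (ℕₚ.≤-pred (ℕₚ.≤-pred (subst₂ _<_ (cong suc (ℕₚ.+-suc m h)) (2*suc k) lt)))
  van′ : ∀ h k → suc m ℕ.+ h < 2 ℕ.* k → step 1ℤ 1ℤ 0ℤ φ h k ≡ 0ℤ
  van′ h k lt rewrite van (suc h) k (subst (_< 2 ℕ.* k) (sym (ℕₚ.+-suc m h)) lt)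
    | van h k (ℕₚ.<-trans (ℕₚ.n<1+n _) lt) | down-van h k lt = refl

motzkin-degree : ∀ n k → n < 2 ℕ.* k → motzkin n k ≡ 0ℤ
motzkin-degree n k lt = paths-degree n 0 (λ _ → 1P) van 0 k
  (subst (_< 2 ℕ.* k) (sym (trans (ℕₚ.+-identityʳ _) (ℕₚ.+-identityʳ n))) lt)
  where
  van : ∀ h k → h < 2 ℕ.* k → 1P k ≡ 0ℤ
  van h zero ()
  van h (suc k) _ = refl

-- Dual to the degree bound: 2 ord φ_h ≥ m + h gains at least 1 per step. Up and down steps gain
-- exactly 1, and a flat step gains 2, since its weight here is -t with no constant part.
paths-order : ∀ n m (φ : ℕ → Poly) → (∀ h k → 2 ℕ.* k < m ℕ.+ h → φ h k ≡ 0ℤ) →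
  ∀ h k → 2 ℕ.* k < n ℕ.+ m ℕ.+ h → paths -1ℤ 0ℤ -1ℤ n φ h k ≡ 0ℤ
paths-order zero m φ van = van
paths-order (suc n) m φ van h k n< =
  paths-order n (suc m) (step -1ℤ 0ℤ -1ℤ φ) van′ h k
    (subst (λ z → 2 ℕ.* k < z ℕ.+ h) (sym (ℕₚ.+-suc n m)) n<)
  where
  shift-van : ∀ h k → 2 ℕ.* k < suc (suc (m ℕ.+ h)) → shift (φ h) k ≡ 0ℤ
  shift-van h zero _ = refl
  shift-van h (suc k) lt =
    van h k (ℕₚ.≤-pred (ℕₚ.≤-pred (subst (_< suc (suc (m ℕ.+ h))) (2*suc k) lt)))
  down-van : ∀ h k → 2 ℕ.* k < suc (m ℕ.+ h) → down φ h k ≡ 0ℤ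
  down-van zero k _ = refl
  down-van (suc h) k lt = shift-van h k (subst (2 ℕ.* k <_) (cong suc (ℕₚ.+-suc m h)) lt)
  van′ : ∀ h k → 2 ℕ.* k < suc m ℕ.+ h → step -1ℤ 0ℤ -1ℤ φ h k ≡ 0ℤ
  van′ h k lt rewrite van (suc h) k (subst (2 ℕ.* k <_) (sym (ℕₚ.+-suc m h)) lt)
    | shift-van h k (ℕₚ.m≤n⇒m≤1+n lt) | down-van h k lt = ℤₚ.+-identityʳ _

-- Multiplication by 1 - a t.
linMul : ℤ → Poly → Poly
linMul a p k = p k ℤ.- a ℤ.* shift p k

linMul-cong : ∀ a {p q : Poly} → p ≗ q → linMul a p ≗ linMul a q
linMul-cong a eq k = cong₂ ℤ._-_ (eq k) (cong (a ℤ.*_) (shift-cong eq k))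

-- The sum over J ⊆ [n] of (1 − t)^{n − |J|} (−1)^{|J|} q_{|J|}.
binT : ℕ → (ℕ → Poly) → Poly
binT zero q = q 0
binT (suc n) q k = linMul 1ℤ (binT n q) k ℤ.- binT n (q ∘ suc) k

-- A binomial transform only changes the weight of the flat steps.
binT-paths : ∀ n (φ : ℕ → Poly) k →
  binT n (λ j → paths 1ℤ 1ℤ 0ℤ j φ 0) k ≡ paths -1ℤ 0ℤ -1ℤ n φ 0 k
binT-paths zero φ k = refl
binT-paths (suc n) φ k = begin
  linMul 1ℤ (binT n (λ j → paths 1ℤ 1ℤ 0ℤ j φ 0)) k ℤ.- binT n (λ j → paths 1ℤ 1ℤ 0ℤ j (step 1ℤ 1ℤ 0ℤ φ) 0) k
    ≡⟨ cong₂ ℤ._-_ (linMul-cong 1ℤ (binT-paths n φ) k) (binT-paths n (step 1ℤ 1ℤ 0ℤ φ) k) ⟩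
  (P φ k ℤ.- 1ℤ ℤ.* shift (P φ) k) ℤ.- P (step 1ℤ 1ℤ 0ℤ φ) k
    ≡⟨ cong (λ z → (P φ k ℤ.- 1ℤ ℤ.* z) ℤ.- P (step 1ℤ 1ℤ 0ℤ φ) k) (sym (N.paths-shift n φ 0 k)) ⟩
  (P φ k ℤ.- 1ℤ ℤ.* P (λ i → shift (φ i)) k) ℤ.- P (step 1ℤ 1ℤ 0ℤ φ) k
    ≡⟨ ring (P φ k) _ _ ⟩
  1ℤ ℤ.* (1ℤ ℤ.* P φ k ℤ.+ -1ℤ ℤ.* P (λ i → shift (φ i)) k) ℤ.+ -1ℤ ℤ.* P (step 1ℤ 1ℤ 0ℤ φ) k
    ≡⟨ cong (λ z → 1ℤ ℤ.* z ℤ.+ -1ℤ ℤ.* P (step 1ℤ 1ℤ 0ℤ φ) k) (sym (N.paths-lin n 1ℤ -1ℤ φ (λ i → shift (φ i)) 0 k)) ⟩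
  1ℤ ℤ.* P (λ i j → 1ℤ ℤ.* φ i j ℤ.+ -1ℤ ℤ.* shift (φ i) j) k ℤ.+ -1ℤ ℤ.* P (step 1ℤ 1ℤ 0ℤ φ) k
    ≡⟨ sym (N.paths-lin n 1ℤ -1ℤ _ (step 1ℤ 1ℤ 0ℤ φ) 0 k) ⟩
  P (λ i j → 1ℤ ℤ.* (1ℤ ℤ.* φ i j ℤ.+ -1ℤ ℤ.* shift (φ i) j) ℤ.+ -1ℤ ℤ.* step 1ℤ 1ℤ 0ℤ φ i j) k
    ≡⟨ N.paths-cong n (λ h j → ring′ (φ (suc h) j) (φ h j) (shift (φ h) j) (down φ h j)) 0 k ⟩
  P (step -1ℤ 0ℤ -1ℤ φ) k ∎
  where
  open ≡-Reasoning
  module N = Paths -1ℤ 0ℤ -1ℤ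
  P : (ℕ → Poly) → Poly
  P ψ = paths -1ℤ 0ℤ -1ℤ n ψ 0
  ring : ∀ x y z → (x ℤ.- 1ℤ ℤ.* y) ℤ.- z ≡ 1ℤ ℤ.* (1ℤ ℤ.* x ℤ.+ -1ℤ ℤ.* y) ℤ.+ -1ℤ ℤ.* z
  ring = solve-∀
  ring′ : ∀ x y z w →
    1ℤ ℤ.* (1ℤ ℤ.* y ℤ.+ -1ℤ ℤ.* z) ℤ.+ -1ℤ ℤ.* (1ℤ ℤ.* x ℤ.+ 1ℤ ℤ.* y ℤ.+ 0ℤ ℤ.* z ℤ.+ 1ℤ ℤ.* w) ≡
    -1ℤ ℤ.* x ℤ.+ 0ℤ ℤ.* y ℤ.+ -1ℤ ℤ.* z ℤ.+ -1ℤ ℤ.* w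
  ring′ = solve-∀

-- Multiplication by -(1 + 2t), the eigenvalue of `harmonic` for the weights -1, -t, -t.
negMul : Poly → Poly
negMul p k = ℤ.- p k ℤ.- + 2 ℤ.* shift p k

iter : {A : Set} → ℕ → (A → A) → A → A
iter zero f a = a
iter (suc n) f a = f (iter n f a)

negMul-cong : ∀ {p q : Poly} → p ≗ q → negMul p ≗ negMul q
negMul-cong eq k = cong₂ (λ a b → ℤ.- a ℤ.- + 2 ℤ.* b) (eq k) (shift-cong eq k)

eigen-paths : ∀ n (φ : ℕ → Poly) → (∀ h → step -1ℤ 0ℤ -1ℤ φ h ≗ negMul (φ h)) →
  iter n negMul (φ 0) ≗ paths -1ℤ 0ℤ -1ℤ n φ 0
eigen-paths zero φ eig k = refl
eigen-paths (suc n) φ eig k = begin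
  negMul (iter n negMul (φ 0)) k
    ≡⟨ negMul-cong (eigen-paths n φ eig) k ⟩
  ℤ.- P φ k ℤ.- + 2 ℤ.* shift (P φ) k
    ≡⟨ cong (λ z → ℤ.- P φ k ℤ.- + 2 ℤ.* z) (sym (N.paths-shift n φ 0 k)) ⟩
  ℤ.- P φ k ℤ.- + 2 ℤ.* P (λ i → shift (φ i)) k
    ≡⟨ ring (P φ k) _ ⟩
  -1ℤ ℤ.* P φ k ℤ.+ -[1+ 1 ] ℤ.* P (λ i → shift (φ i)) k
    ≡⟨ sym (N.paths-lin n -1ℤ -[1+ 1 ] φ (λ i → shift (φ i)) 0 k) ⟩
  P (λ i j → -1ℤ ℤ.* φ i j ℤ.+ -[1+ 1 ] ℤ.* shift (φ i) j) k
    ≡⟨ N.paths-cong n (λ h j → trans (sym (ring (φ h j) (shift (φ h) j))) (sym (eig h j))) 0 k ⟩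
  P (step -1ℤ 0ℤ -1ℤ φ) k ∎
  where
  open ≡-Reasoning
  module N = Paths -1ℤ 0ℤ -1ℤ
  P : (ℕ → Poly) → Poly
  P ψ = paths -1ℤ 0ℤ -1ℤ n ψ 0
  ring : ∀ x y → ℤ.- x ℤ.- + 2 ℤ.* y ≡ -1ℤ ℤ.* x ℤ.+ -[1+ 1 ] ℤ.* y
  ring = solve-∀

-- 1 − t^{h+1} vanishes at h = −1, so it is an eigenfunction of the step
-- operator on all heights h ≥ 0.
harmonic : ℕ → Poly
harmonic h k = 1P k ℤ.- mono 1ℤ (suc h) k

mono-suc : ∀ c d → mono c (suc d) ≗ shift (mono c d)
mono-suc c d zero = refl
mono-suc c d (suc k) = refl

shift-harmonic : ∀ h k → shift (harmonic h) k ≡ shift 1P k ℤ.- mono 1ℤ (suc (suc h)) k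
shift-harmonic h zero = refl
shift-harmonic h (suc k) = refl

mono-1-0 : ∀ k → mono 1ℤ 0 k ≡ 1P k
mono-1-0 zero = refl
mono-1-0 (suc k) = refl

down-harmonic : ∀ h k → down harmonic h k ≡ shift 1P k ℤ.- mono 1ℤ (suc h) k
down-harmonic zero zero = refl
down-harmonic zero (suc k) = sym (trans (cong (λ z → 1P k ℤ.- z) (mono-1-0 k)) (ℤₚ.+-inverseʳ (1P k)))
down-harmonic (suc h) k = shift-harmonic h k

harmonic-eigen : ∀ h → step -1ℤ 0ℤ -1ℤ harmonic h ≗ negMul (harmonic h)
harmonic-eigen h k rewrite shift-harmonic h k | down-harmonic h k =
  ring (1P k) (shift 1P k) (mono 1ℤ (suc h) k) (mono 1ℤ (suc (suc h)) k)
  where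
  ring : ∀ o s m m′ →
    -1ℤ ℤ.* (o ℤ.- m′) ℤ.+ 0ℤ ℤ.* (o ℤ.- m) ℤ.+ -1ℤ ℤ.* (s ℤ.- m′) ℤ.+ -1ℤ ℤ.* (s ℤ.- m) ≡
    ℤ.- (o ℤ.- m) ℤ.- + 2 ℤ.* (s ℤ.- m′)
  ring = solve-∀

linMul-negMul : ∀ a p → linMul a (negMul p) ≗ negMul (linMul a p)
linMul-negMul a p zero = ring a (p 0)
  where
  ring : ∀ a x → ℤ.- x ℤ.- + 2 ℤ.* 0ℤ ℤ.- a ℤ.* 0ℤ ≡ ℤ.- (x ℤ.- a ℤ.* 0ℤ) ℤ.- + 2 ℤ.* 0ℤ
  ring = solve-∀
linMul-negMul a p (suc k) = ring a (p (suc k)) (p k) (shift p k)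
  where
  ring : ∀ a x y z → ℤ.- x ℤ.- + 2 ℤ.* y ℤ.- a ℤ.* (ℤ.- y ℤ.- + 2 ℤ.* z) ≡
    ℤ.- (x ℤ.- a ℤ.* y) ℤ.- + 2 ℤ.* (y ℤ.- a ℤ.* z)
  ring = solve-∀

linMul-iter-negMul : ∀ a n p → linMul a (iter n negMul p) ≗ iter n negMul (linMul a p)
linMul-iter-negMul a zero p k = refl
linMul-iter-negMul a (suc n) p k =
  trans (linMul-negMul a (iter n negMul p) k) (negMul-cong (linMul-iter-negMul a n p) k)

iter-negMul-cong : ∀ n {p q : Poly} → p ≗ q → iter n negMul p ≗ iter n negMul q
iter-negMul-cong zero eq = eq
iter-negMul-cong (suc n) eq = negMul-cong (iter-negMul-cong n eq)

-- The factor 1 - t is `harmonic 0`, so both summands are path sums for the weights -1, -t, -t, with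
-- end weights -1 and 1 - t^{h+1}. Together the end weight is -t^{h+1}, and 2 (h + 1) ≥ 1 + h allows
-- `paths-order` with m = 1: every term has degree at least (n + 1)/2.
kl-identity : ∀ n k → 2 ℕ.* k ≤ n →
  ℤ.- binT n motzkin k ℤ.+ linMul 1ℤ (iter n negMul 1P) k ≡ 0ℤ
kl-identity n k 2k≤n = begin
  ℤ.- binT n motzkin k ℤ.+ linMul 1ℤ (iter n negMul 1P) k
    ≡⟨ cong₂ (λ a b → ℤ.- a ℤ.+ b) (binT-paths n (λ _ → 1P) k)
         (trans (linMul-iter-negMul 1ℤ n 1P k)
           (trans (iter-negMul-cong n linMul-1P k) (eigen-paths n harmonic harmonic-eigen k))) ⟩
  ℤ.- P (λ _ → 1P) k ℤ.+ P harmonic k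
    ≡⟨ ring (P (λ _ → 1P) k) (P harmonic k) ⟩
  -1ℤ ℤ.* P (λ _ → 1P) k ℤ.+ 1ℤ ℤ.* P harmonic k
    ≡⟨ sym (Paths.paths-lin -1ℤ 0ℤ -1ℤ n -1ℤ 1ℤ (λ _ → 1P) harmonic 0 k) ⟩
  P (λ i j → -1ℤ ℤ.* 1P j ℤ.+ 1ℤ ℤ.* harmonic i j) k
    ≡⟨ paths-order n 1 _ low 0 k
         (subst (2 ℕ.* k <_) (sym (trans (ℕₚ.+-identityʳ _) (ℕₚ.+-comm n 1))) (s≤s 2k≤n)) ⟩
  0ℤ ∎
  where
  open ≡-Reasoning
  P : (ℕ → Poly) → Poly
  P ψ = paths -1ℤ 0ℤ -1ℤ n ψ 0
  ring : ∀ x y → ℤ.- x ℤ.+ y ≡ -1ℤ ℤ.* x ℤ.+ 1ℤ ℤ.* y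
  ring = solve-∀
  linMul-1P : linMul 1ℤ 1P ≗ harmonic 0
  linMul-1P zero = refl
  linMul-1P (suc k) = cong (λ z → 1P (suc k) ℤ.- z) (trans (ℤₚ.*-identityˡ (1P k)) (sym (mono-1-0 k)))
  ring′ : ∀ x → -1ℤ ℤ.* x ℤ.+ 1ℤ ℤ.* (x ℤ.- 0ℤ) ≡ 0ℤ
  ring′ = solve-∀
  low : ∀ h k → 2 ℕ.* k < suc h → -1ℤ ℤ.* 1P k ℤ.+ 1ℤ ℤ.* harmonic h k ≡ 0ℤ
  low h k lt rewrite ≢⇒≡ᵇ-false (suc h) k
    (λ eq → ℕₚ.<-irrefl (sym eq) (ℕₚ.≤-<-trans (ℕₚ.m≤m+n k (k ℕ.+ 0)) lt)) = ring′ (1P k)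

-- Ballot numbers as coefficients of the prefix polynomials.

prev : (ℕ → ℕ) → ℕ → ℕ
prev f zero = 0
prev f (suc k) = f k

-- The number of Motzkin prefixes with n steps, final height h and k down steps.
prefixes : ℕ → ℕ → ℕ → ℕ
prefixes zero zero zero = 1
prefixes zero zero (suc k) = 0
prefixes zero (suc h) k = 0
prefixes (suc n) h k =
  prev (λ i → prefixes n i k) h ℕ.+ prefixes n h k ℕ.+ prev (prefixes n (suc h)) k

-- With k down steps and final height h there are h + k up steps, hence at least h + 2k steps.
prefixes-zero : ∀ n h k → n < h ℕ.+ 2 ℕ.* k → prefixes n h k ≡ 0
prefixes-zero zero zero zero ()
prefixes-zero zero zero (suc k) lt = refl
prefixes-zero zero (suc h) k lt = refl
prefixes-zero (suc n) h k lt = cong₂ ℕ._+_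
  (cong₂ ℕ._+_ (up h k lt) (prefixes-zero n h k (ℕₚ.<-trans (ℕₚ.n<1+n n) lt))) (dn h k lt)
  where
  up : ∀ h k → suc n < h ℕ.+ 2 ℕ.* k → prev (λ i → prefixes n i k) h ≡ 0
  up zero k lt = refl
  up (suc h) k lt = prefixes-zero n h k (ℕₚ.≤-pred lt)
  arith : ∀ h k → h ℕ.+ 2 ℕ.* suc k ≡ suc (suc h ℕ.+ 2 ℕ.* k)
  arith = solveℕ-∀
  dn : ∀ h k → suc n < h ℕ.+ 2 ℕ.* k → prev (prefixes n (suc h)) k ≡ 0
  dn h zero lt = refl
  dn h (suc k) lt =
    prefixes-zero n (suc h) k (ℕₚ.≤-pred (subst (suc n <_) (arith h k) lt))

-- The ballot formula (h+1) n! / (k! b! (h+k+1)!) with denominators cleared; b is the number of flat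
-- steps. For length n + 1, the prefixes with last step up, flat and down contribute h (h+k+1), b
-- (h+1) and k (h+2) times n!, and these add up to (h+1)(h+2k+b) n! = (h+1)(n+1)!.
prefixes-closed : ∀ n h k b → n ≡ h ℕ.+ 2 ℕ.* k ℕ.+ b →
  prefixes n h k ℕ.* ((k ! ℕ.* b !) ℕ.* suc (h ℕ.+ k) !) ≡ suc h ℕ.* n !
prefixes-closed zero zero zero zero refl = refl
prefixes-closed (suc n) h k b n≡ = begin
  (U ℕ.+ F ℕ.+ D) ℕ.* W
    ≡⟨ distrib U F D W ⟩
  U ℕ.* W ℕ.+ F ℕ.* W ℕ.+ D ℕ.* W
    ≡⟨ cong₂ ℕ._+_ (cong₂ ℕ._+_ (up h n≡) (flat b n≡)) (dn k n≡) ⟩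
  h ℕ.* suc (h ℕ.+ k) ℕ.* n ! ℕ.+ b ℕ.* suc h ℕ.* n ! ℕ.+ k ℕ.* suc (suc h) ℕ.* n !
    ≡⟨ collect h k b (n !) ⟩
  suc h ℕ.* ((h ℕ.+ 2 ℕ.* k ℕ.+ b) ℕ.* n !)
    ≡⟨ cong (λ m → suc h ℕ.* (m ℕ.* n !)) (sym n≡) ⟩
  suc h ℕ.* (suc n ℕ.* n !) ∎
  where
  open ≡-Reasoning
  U = prev (λ i → prefixes n i k) h
  F = prefixes n h k
  D = prev (prefixes n (suc h)) k
  W = (k ! ℕ.* b !) ℕ.* suc (h ℕ.+ k) !
  distrib : ∀ u f d w → (u ℕ.+ f ℕ.+ d) ℕ.* w ≡ u ℕ.* w ℕ.+ f ℕ.* w ℕ.+ d ℕ.* w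
  distrib = solveℕ-∀
  collect : ∀ h k b m →
    h ℕ.* suc (h ℕ.+ k) ℕ.* m ℕ.+ b ℕ.* suc h ℕ.* m ℕ.+ k ℕ.* suc (suc h) ℕ.* m ≡
    suc h ℕ.* ((h ℕ.+ 2 ℕ.* k ℕ.+ b) ℕ.* m)
  collect = solveℕ-∀
  up : ∀ h → suc n ≡ h ℕ.+ 2 ℕ.* k ℕ.+ b →
    prev (λ i → prefixes n i k) h ℕ.* ((k ! ℕ.* b !) ℕ.* suc (h ℕ.+ k) !) ≡
      h ℕ.* suc (h ℕ.+ k) ℕ.* n !
  up zero _ = refl
  up (suc h) eq = begin
    prefixes n h k ℕ.* ((k ! ℕ.* b !) ℕ.* (suc (suc h ℕ.+ k) ℕ.* suc (h ℕ.+ k) !))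
      ≡⟨ pull (prefixes n h k) (k !) (b !) (suc (suc h ℕ.+ k)) (suc (h ℕ.+ k) !) ⟩
    suc (suc h ℕ.+ k) ℕ.* (prefixes n h k ℕ.* ((k ! ℕ.* b !) ℕ.* suc (h ℕ.+ k) !))
      ≡⟨ cong (suc (suc h ℕ.+ k) ℕ.*_) (prefixes-closed n h k b (ℕₚ.suc-injective eq)) ⟩
    suc (suc h ℕ.+ k) ℕ.* (suc h ℕ.* n !)
      ≡⟨ swap (suc (suc h ℕ.+ k)) (suc h) (n !) ⟩
    suc h ℕ.* suc (suc h ℕ.+ k) ℕ.* n ! ∎
    where
    pull : ∀ p x y z w → p ℕ.* ((x ℕ.* y) ℕ.* (z ℕ.* w)) ≡ z ℕ.* (p ℕ.* ((x ℕ.* y) ℕ.* w))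
    pull = solveℕ-∀
    swap : ∀ x y z → x ℕ.* (y ℕ.* z) ≡ y ℕ.* x ℕ.* z
    swap = solveℕ-∀
  flat : ∀ b → suc n ≡ h ℕ.+ 2 ℕ.* k ℕ.+ b →
    prefixes n h k ℕ.* ((k ! ℕ.* b !) ℕ.* suc (h ℕ.+ k) !) ≡ b ℕ.* suc h ℕ.* n !
  flat zero eq = cong (ℕ._* ((k ! ℕ.* 1) ℕ.* suc (h ℕ.+ k) !))
    (prefixes-zero n h k (ℕₚ.≤-reflexive (trans eq (ℕₚ.+-identityʳ _))))
  flat (suc b) eq = begin
    prefixes n h k ℕ.* ((k ! ℕ.* (suc b ℕ.* b !)) ℕ.* suc (h ℕ.+ k) !)
      ≡⟨ pull (prefixes n h k) (k !) (suc b) (b !) (suc (h ℕ.+ k) !) ⟩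
    suc b ℕ.* (prefixes n h k ℕ.* ((k ! ℕ.* b !) ℕ.* suc (h ℕ.+ k) !))
      ≡⟨ cong (suc b ℕ.*_) (prefixes-closed n h k b (ℕₚ.suc-injective (trans eq (ℕₚ.+-suc _ b)))) ⟩
    suc b ℕ.* (suc h ℕ.* n !)
      ≡⟨ sym (ℕₚ.*-assoc (suc b) (suc h) (n !)) ⟩
    suc b ℕ.* suc h ℕ.* n ! ∎
    where
    pull : ∀ p x y z w → p ℕ.* ((x ℕ.* (y ℕ.* z)) ℕ.* w) ≡ y ℕ.* (p ℕ.* ((x ℕ.* z) ℕ.* w))
    pull = solveℕ-∀
  dn : ∀ k → suc n ≡ h ℕ.+ 2 ℕ.* k ℕ.+ b →
    prev (prefixes n (suc h)) k ℕ.* ((k ! ℕ.* b !) ℕ.* suc (h ℕ.+ k) !) ≡ k ℕ.* suc (suc h) ℕ.* n !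
  dn zero _ = refl
  dn (suc k) eq = begin
    prefixes n (suc h) k ℕ.* (((suc k ℕ.* k !) ℕ.* b !) ℕ.* suc (h ℕ.+ suc k) !)
      ≡⟨ cong (λ m → prefixes n (suc h) k ℕ.* (((suc k ℕ.* k !) ℕ.* b !) ℕ.* suc m !)) (ℕₚ.+-suc h k) ⟩
    prefixes n (suc h) k ℕ.* (((suc k ℕ.* k !) ℕ.* b !) ℕ.* suc (suc h ℕ.+ k) !)
      ≡⟨ pull (prefixes n (suc h) k) (suc k) (k !) (b !) (suc (suc h ℕ.+ k) !) ⟩
    suc k ℕ.* (prefixes n (suc h) k ℕ.* ((k ! ℕ.* b !) ℕ.* suc (suc h ℕ.+ k) !))
      ≡⟨ cong (suc k ℕ.*_) (prefixes-closed n (suc h) k b (ℕₚ.suc-injective (trans eq (arith h k b)))) ⟩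
    suc k ℕ.* (suc (suc h) ℕ.* n !)
      ≡⟨ sym (ℕₚ.*-assoc (suc k) (suc (suc h)) (n !)) ⟩
    suc k ℕ.* suc (suc h) ℕ.* n ! ∎
    where
    pull : ∀ p x y z w → p ℕ.* (((x ℕ.* y) ℕ.* z) ℕ.* w) ≡ x ℕ.* (p ℕ.* ((y ℕ.* z) ℕ.* w))
    pull = solveℕ-∀
    arith : ∀ h k b → h ℕ.+ 2 ℕ.* suc k ℕ.+ b ≡ suc (suc h ℕ.+ 2 ℕ.* k ℕ.+ b)
    arith = solveℕ-∀

endAt : ℕ → ℕ → Poly
endAt h i k = if h ≡ᵇ i then 1P k else 0ℤ

endAt-step : ∀ h i k → down (endAt h) i k ≡ shift (endAt (suc h) i) k
endAt-step h zero zero = refl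
endAt-step h zero (suc k) = refl
endAt-step h (suc i) k = refl

module Motzkin = Paths 1ℤ 1ℤ 0ℤ

-- The step operator acts on end weights, whereas `prefixes` recurses on the final height. Applied
-- to the indicator of h, the operator gives the indicators of h - 1 and h and t times that of h +
-- 1, which is the recursion of `prefixes`.
paths-endAt : ∀ n h k → Motzkin.paths n (endAt h) 0 k ≡ + prefixes n h k
paths-endAt zero zero zero = refl
paths-endAt zero zero (suc k) = refl
paths-endAt zero (suc h) k = refl
paths-endAt (suc n) h k = begin
  Motzkin.paths n (Motzkin.step (endAt h)) 0 k
    ≡⟨ Motzkin.paths-cong n (λ i j → trans
         (cong (λ z → 1ℤ ℤ.* endAt h (suc i) j ℤ.+ 1ℤ ℤ.* endAt h i j ℤ.+ 0ℤ ℤ.* shift (endAt h i) j ℤ.+ 1ℤ ℤ.* z)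
           (endAt-step h i j))
         (ring (endAt h (suc i) j) (endAt h i j) (shift (endAt h i) j) (shift (endAt (suc h) i) j))) 0 k ⟩
  P (λ i j → 1ℤ ℤ.* (1ℤ ℤ.* endAt h (suc i) j ℤ.+ 1ℤ ℤ.* endAt h i j) ℤ.+ 1ℤ ℤ.* shift (endAt (suc h) i) j)
    ≡⟨ Motzkin.paths-lin n 1ℤ 1ℤ _ (λ i → shift (endAt (suc h) i)) 0 k ⟩
  1ℤ ℤ.* P (λ i j → 1ℤ ℤ.* endAt h (suc i) j ℤ.+ 1ℤ ℤ.* endAt h i j) ℤ.+ 1ℤ ℤ.* P (λ i → shift (endAt (suc h) i))
    ≡⟨ cong (λ z → 1ℤ ℤ.* z ℤ.+ 1ℤ ℤ.* P (λ i → shift (endAt (suc h) i)))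
         (Motzkin.paths-lin n 1ℤ 1ℤ (λ i → endAt h (suc i)) (endAt h) 0 k) ⟩
  1ℤ ℤ.* (1ℤ ℤ.* P (λ i → endAt h (suc i)) ℤ.+ 1ℤ ℤ.* P (endAt h)) ℤ.+ 1ℤ ℤ.* P (λ i → shift (endAt (suc h) i))
    ≡⟨ ring′ (P (λ i → endAt h (suc i))) _ _ ⟩
  P (λ i → endAt h (suc i)) ℤ.+ P (endAt h) ℤ.+ P (λ i → shift (endAt (suc h) i))
    ≡⟨ cong₂ ℤ._+_ (cong₂ ℤ._+_ (up h) (paths-endAt n h k)) (trans (Motzkin.paths-shift n (endAt (suc h)) 0 k) (dn k)) ⟩
  + prefixes (suc n) h k ∎
  where
  open ≡-Reasoning
  P : (ℕ → Poly) → ℤ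
  P φ = Motzkin.paths n φ 0 k
  ring : ∀ x y z w → 1ℤ ℤ.* x ℤ.+ 1ℤ ℤ.* y ℤ.+ 0ℤ ℤ.* z ℤ.+ 1ℤ ℤ.* w ≡ 1ℤ ℤ.* (1ℤ ℤ.* x ℤ.+ 1ℤ ℤ.* y) ℤ.+ 1ℤ ℤ.* w
  ring = solve-∀
  ring′ : ∀ x y w → 1ℤ ℤ.* (1ℤ ℤ.* x ℤ.+ 1ℤ ℤ.* y) ℤ.+ 1ℤ ℤ.* w ≡ x ℤ.+ y ℤ.+ w
  ring′ = solve-∀
  up : ∀ h → P (λ i → endAt h (suc i)) ≡ + prev (λ i → prefixes n i k) h
  up zero = Motzkin.paths-high n 1 (λ _ _ → 0ℤ) (λ _ _ _ → refl) 0 k (s≤s z≤n)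
  up (suc h) = paths-endAt n h k
  dn : ∀ k → shift (Motzkin.paths n (endAt (suc h)) 0) k ≡ + prev (prefixes n (suc h)) k
  dn zero = refl
  dn (suc k) = paths-endAt n (suc h) k

sumBelow : ℕ → (ℕ → ℕ) → ℕ
sumBelow zero f = 0
sumBelow (suc n) f = f 0 ℕ.+ sumBelow n (f ∘ suc)

sumBelow-snoc : ∀ n f → sumBelow (suc n) f ≡ sumBelow n f ℕ.+ f n
sumBelow-snoc zero f = ℕₚ.+-identityʳ (f 0)
sumBelow-snoc (suc n) f =
  trans (cong (f 0 ℕ.+_) (sumBelow-snoc n (f ∘ suc))) (sym (ℕₚ.+-assoc (f 0) _ _))

sumBelow-reverse : ∀ n f → sumBelow (suc n) (λ j → f (n ∸ j)) ≡ sumBelow (suc n) f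
sumBelow-reverse zero f = refl
sumBelow-reverse (suc n) f = begin
  f (suc n) ℕ.+ sumBelow (suc n) (λ j → f (n ∸ j)) ≡⟨ cong (f (suc n) ℕ.+_) (sumBelow-reverse n f) ⟩
  f (suc n) ℕ.+ sumBelow (suc n) f                 ≡⟨ ℕₚ.+-comm (f (suc n)) _ ⟩
  sumBelow (suc n) f ℕ.+ f (suc n)                 ≡⟨ sym (sumBelow-snoc (suc n) f) ⟩
  sumBelow (suc (suc n)) f ∎
  where open ≡-Reasoning

sumBelow-extend : ∀ m d f → (∀ h → d ≤ h → f h ≡ 0) → sumBelow (m ℕ.+ d) f ≡ sumBelow d f
sumBelow-extend zero d f van = refl
sumBelow-extend (suc m) d f van =
  trans (sumBelow-snoc (m ℕ.+ d) f)
    (trans (cong₂ ℕ._+_ (sumBelow-extend m d f van) (van (m ℕ.+ d) (ℕₚ.m≤n+m d m)))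
      (ℕₚ.+-identityʳ _))

-- The indicator of the end heights at least h. The constant end weight of `motzkin` is `above 0`,
-- and splitting off one height at a time turns it into a sum over final heights.
above : ℕ → ℕ → Poly
above h i k = if h ℕ.≤ᵇ i then 1P k else 0ℤ

above-split : ∀ h i k → above h i k ≡ 1ℤ ℤ.* endAt h i k ℤ.+ 1ℤ ℤ.* above (suc h) i k
above-split zero zero k = ring (1P k)
  where
  ring : ∀ x → x ≡ 1ℤ ℤ.* x ℤ.+ 1ℤ ℤ.* 0ℤ
  ring = solve-∀
above-split zero (suc i) k = ring (1P k)
  where
  ring : ∀ x → x ≡ 1ℤ ℤ.* 0ℤ ℤ.+ 1ℤ ℤ.* x
  ring = solve-∀
above-split (suc h) zero k = refl
above-split (suc zero) (suc i) k = above-split zero i k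
above-split (suc (suc h)) (suc i) k = above-split (suc h) i k

above-low : ∀ h i k → i < h → above h i k ≡ 0ℤ
above-low (suc h) zero k _ = refl
above-low (suc zero) (suc i) k (s≤s ())
above-low (suc (suc h)) (suc i) k (s≤s lt) = above-low (suc h) i k lt

paths-above : ∀ n k N h → N ℕ.+ h ≡ suc n →
  Motzkin.paths n (above h) 0 k ≡ + sumBelow N (λ i → prefixes n (h ℕ.+ i) k)
paths-above n k zero h refl =
  -- Here h = n + 1, a height that n steps from 0 cannot reach.
  Motzkin.paths-high n 1 (above h) (λ i j lt → above-low (suc n) i j (subst (i <_) (ℕₚ.+-comm n 1) lt)) 0 k (s≤s z≤n)
paths-above n k (suc N) h eq = begin
  Motzkin.paths n (above h) 0 k
    ≡⟨ Motzkin.paths-cong n (above-split h) 0 k ⟩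
  Motzkin.paths n (λ i j → 1ℤ ℤ.* endAt h i j ℤ.+ 1ℤ ℤ.* above (suc h) i j) 0 k
    ≡⟨ Motzkin.paths-lin n 1ℤ 1ℤ (endAt h) (above (suc h)) 0 k ⟩
  1ℤ ℤ.* Motzkin.paths n (endAt h) 0 k ℤ.+ 1ℤ ℤ.* Motzkin.paths n (above (suc h)) 0 k
    ≡⟨ cong₂ ℤ._+_ (ℤₚ.*-identityˡ (Motzkin.paths n (endAt h) 0 k)) (ℤₚ.*-identityˡ (Motzkin.paths n (above (suc h)) 0 k)) ⟩
  Motzkin.paths n (endAt h) 0 k ℤ.+ Motzkin.paths n (above (suc h)) 0 k
    ≡⟨ cong₂ ℤ._+_ (trans (paths-endAt n h k) (cong (λ i → + prefixes n i k) (sym (ℕₚ.+-identityʳ h))))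
         (trans (paths-above n k N (suc h) (trans (ℕₚ.+-suc N h) eq))
           (cong +_ (sumBelow-cong N (λ i → cong (λ m → prefixes n m k) (sym (ℕₚ.+-suc h i)))))) ⟩
  + sumBelow (suc N) (λ i → prefixes n (h ℕ.+ i) k) ∎
  where
  open ≡-Reasoning
  sumBelow-cong : ∀ N {f g : ℕ → ℕ} → (∀ i → f i ≡ g i) → sumBelow N f ≡ sumBelow N g
  sumBelow-cong zero eq = refl
  sumBelow-cong (suc N) eq = cong₂ ℕ._+_ (eq 0) (sumBelow-cong N (eq ∘ suc))

motzkin-prefixes : ∀ n k → motzkin n k ≡ + sumBelow (suc n) (λ h → prefixes n h k)
motzkin-prefixes n k = paths-above n k (suc n) 0 (ℕₚ.+-identityʳ _)

-- Comparison with the multinomial formula over the rationals.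

toℚᵘ-/ : ∀ p d .{{_ : NonZero d}} → ℚ.toℚᵘ (p / d) ℚᵘ.≃ p ℚᵘ./ d
toℚᵘ-/ p (suc d) = ℚₚ.toℚᵘ-fromℚᵘ (mkℚᵘ p d)

/-* : ∀ p a b c d .{{_ : NonZero b}} .{{_ : NonZero d}} → p ℕ.* (b ℕ.* d) ≡ a ℕ.* c →
  (+ a / b) ℚ.* (+ c / d) ≡ + p / 1
/-* p a b@(suc _) c d@(suc _) eq = ℚₚ.toℚᵘ-injective (begin
  ℚ.toℚᵘ ((+ a / b) ℚ.* (+ c / d))
    ≈⟨ ℚₚ.toℚᵘ-homo-* (+ a / b) (+ c / d) ⟩
  ℚ.toℚᵘ (+ a / b) ℚᵘ.* ℚ.toℚᵘ (+ c / d)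
    ≈⟨ ℚᵘₚ.*-cong (toℚᵘ-/ (+ a) b) (toℚᵘ-/ (+ c) d) ⟩
  (+ a ℚᵘ./ b) ℚᵘ.* (+ c ℚᵘ./ d)
    ≈⟨ *≡* cross ⟩
  + p ℚᵘ./ 1
    ≈⟨ ℚᵘₚ.≃-sym (toℚᵘ-/ (+ p) 1) ⟩
  ℚ.toℚᵘ (+ p / 1) ∎)
  where
  open import Relation.Binary.Reasoning.Setoid ℚᵘₚ.≃-setoid
  cross : + a ℤ.* + c ℤ.* + 1 ≡ + p ℤ.* + (b ℕ.* d)
  cross = trans (ℤₚ.*-identityʳ _)
    (trans (sym (ℤₚ.pos-* a c)) (trans (cong +_ (sym eq)) (ℤₚ.pos-* p (b ℕ.* d))))

/1-+ : ∀ p q → (p / 1) ℚ.+ (q / 1) ≡ (p ℤ.+ q) / 1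
/1-+ p q = ℚₚ.toℚᵘ-injective (begin
  ℚ.toℚᵘ ((p / 1) ℚ.+ (q / 1))           ≈⟨ ℚₚ.toℚᵘ-homo-+ (p / 1) (q / 1) ⟩
  ℚ.toℚᵘ (p / 1) ℚᵘ.+ ℚ.toℚᵘ (q / 1)     ≈⟨ ℚᵘₚ.+-cong (toℚᵘ-/ p 1) (toℚᵘ-/ q 1) ⟩
  (p ℚᵘ./ 1) ℚᵘ.+ (q ℚᵘ./ 1)             ≈⟨ *≡* (ring p q) ⟩
  (p ℤ.+ q) ℚᵘ./ 1                       ≈⟨ ℚᵘₚ.≃-sym (toℚᵘ-/ (p ℤ.+ q) 1) ⟩
  ℚ.toℚᵘ ((p ℤ.+ q) / 1) ∎)
  where
  open import Relation.Binary.Reasoning.Setoid ℚᵘₚ.≃-setoid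
  ring : ∀ p q → (p ℤ.* 1ℤ ℤ.+ q ℤ.* 1ℤ) ℤ.* 1ℤ ≡ (p ℤ.+ q) ℤ.* 1ℤ
  ring = solve-∀

sum-upTo : ∀ N (f : ℕ → ℕ) (g : ℕ → ℚ) (a : ℕ → ℕ) → (∀ j → j < N → g (f j) ≡ + a j / 1) →
  List.foldr ℚ._+_ ℚ.0ℚ (List.map g (List.applyUpTo f N)) ≡ + sumBelow N a / 1
sum-upTo zero f g a eq = refl
sum-upTo (suc N) f g a eq = trans
  (cong₂ ℚ._+_ (eq 0 (s≤s z≤n)) (sum-upTo N (f ∘ suc) g (a ∘ suc) (λ j lt → eq (suc j) (s≤s lt))))
  (/1-+ (+ a 0) (+ sumBelow N (a ∘ suc)))

≤⌊/2⌋⇒2*≤ : ∀ k n → k ≤ ℕ.⌊ n /2⌋ → 2 ℕ.* k ≤ n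
≤⌊/2⌋⇒2*≤ k n le = ℕₚ.≤-trans
  (ℕₚ.+-mono-≤ le (ℕₚ.≤-trans (ℕₚ.≤-reflexive (ℕₚ.+-identityʳ k)) (ℕₚ.≤-trans le (ℕₚ.⌊n/2⌋≤⌈n/2⌉ n))))
  (ℕₚ.≤-reflexive (ℕₚ.⌊n/2⌋+⌈n/2⌉≡n n))

2*≤⇒≤⌊/2⌋ : ∀ k n → 2 ℕ.* k ≤ n → k ≤ ℕ.⌊ n /2⌋
2*≤⇒≤⌊/2⌋ k n le = subst (_≤ ℕ.⌊ n /2⌋) (sym (ℕₚ.n≡⌊n+n/2⌋ k))
  (ℕₚ.⌊n/2⌋-mono (subst (_≤ n) (cong (k ℕ.+_) (ℕₚ.+-identityʳ k)) le))

-- The index i of the formula is n minus the final height: i - 2k = j is the number of flat steps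
-- and n - i = d - j is the height h. The prefactor (h+1)/(n+1) and the multinomial coefficient of
-- k, j, h+k+1 make up the ballot formula.
thagCoeff-term : ∀ k d j → j ≤ d →
  let n = 2 ℕ.* k ℕ.+ d; i = 2 ℕ.* k ℕ.+ j in
  (+ (n ∸ i ℕ.+ 1) / suc n) ℚ.* multinomial (n ℕ.+ 1) k (i ∸ 2 ℕ.* k) (n ℕ.+ k ∸ i ℕ.+ 1) ≡
    + prefixes n (d ∸ j) k / 1
thagCoeff-term k d j j≤d
  rewrite ℕₚ.[m+n]∸[m+o]≡n∸o (2 ℕ.* k) d j
        | ℕₚ.m+n∸m≡n (2 ℕ.* k) j
        | ℕₚ.+-assoc (2 ℕ.* k) d k
        | ℕₚ.[m+n]∸[m+o]≡n∸o (2 ℕ.* k) (d ℕ.+ k) j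
        | ℕₚ.+-∸-comm k j≤d
        | ℕₚ.+-comm (d ∸ j) 1
        | ℕₚ.+-comm (d ∸ j ℕ.+ k) 1
        | ℕₚ.+-comm (2 ℕ.* k ℕ.+ d) 1 =
  /-* (prefixes n h k) (suc h) (suc n) (suc n !) ((k ! ℕ.* j !) ℕ.* suc (h ℕ.+ k) !)
    {{_}} {{ℕₚ.m*n≢0 _ _ {{ℕₚ.m*n≢0 _ _ {{ℕₚ._!≢0 k}} {{ℕₚ._!≢0 j}}}} {{ℕₚ._!≢0 (suc (h ℕ.+ k))}}}} (begin
  prefixes n h k ℕ.* (suc n ℕ.* W)
    ≡⟨ swap (prefixes n h k) (suc n) W ⟩
  suc n ℕ.* (prefixes n h k ℕ.* W)
    ≡⟨ cong (suc n ℕ.*_) (prefixes-closed n h k j n≡) ⟩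
  suc n ℕ.* (suc h ℕ.* n !)
    ≡⟨ swap (suc n) (suc h) (n !) ⟩
  suc h ℕ.* (suc n ℕ.* n !) ∎)
  where
  open ≡-Reasoning
  n = 2 ℕ.* k ℕ.+ d
  h = d ∸ j
  W = (k ! ℕ.* j !) ℕ.* suc (h ℕ.+ k) !
  swap : ∀ x y z → x ℕ.* (y ℕ.* z) ≡ y ℕ.* (x ℕ.* z)
  swap = solveℕ-∀
  arith : ∀ h k j → 2 ℕ.* k ℕ.+ (h ℕ.+ j) ≡ h ℕ.+ 2 ℕ.* k ℕ.+ j
  arith = solveℕ-∀
  n≡ : n ≡ h ℕ.+ 2 ℕ.* k ℕ.+ j
  n≡ = trans (cong (2 ℕ.* k ℕ.+_) (sym (ℕₚ.m∸n+n≡m j≤d))) (arith h k j)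

motzkin-thagCoeff : ∀ n k → motzkin n k / 1 ≡ thagCoeff n k
motzkin-thagCoeff n k with k ℕ.≤ᵇ ℕ.⌊ n /2⌋ in eq
... | false = cong (_/ 1) (motzkin-degree n k (ℕₚ.≰⇒> λ le →
  subst T eq (ℕₚ.≤⇒≤ᵇ (2*≤⇒≤⌊/2⌋ k n le))))
... | true = subst (λ n → motzkin n k / 1 ≡ sum n) (ℕₚ.m+[n∸m]≡n 2k≤n) (main (n ∸ 2 ℕ.* k))
  where
  2k≤n : 2 ℕ.* k ≤ n
  2k≤n = ≤⌊/2⌋⇒2*≤ k n (ℕₚ.≤ᵇ⇒≤ k ℕ.⌊ n /2⌋ (subst T (sym eq) tt))
  term : ℕ → ℕ → ℚ
  term n i = (+ (n ∸ i ℕ.+ 1) / suc n) ℚ.* multinomial (n ℕ.+ 1) k (i ∸ 2 ℕ.* k) (n ℕ.+ k ∸ i ℕ.+ 1)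
  sum : ℕ → ℚ
  sum n = sumℚ (2 ℕ.* k) n (term n)
  main : ∀ d → motzkin (2 ℕ.* k ℕ.+ d) k / 1 ≡ sum (2 ℕ.* k ℕ.+ d)
  main d = begin
    motzkin N k / 1
      ≡⟨ cong (_/ 1) (motzkin-prefixes N k) ⟩
    + sumBelow (suc N) p / 1
      ≡⟨ cong (λ m → + sumBelow m p / 1) (sym (ℕₚ.+-suc (2 ℕ.* k) d)) ⟩
    + sumBelow (2 ℕ.* k ℕ.+ suc d) p / 1
      -- Only final heights up to d = n - 2k occur; the sum is then reversed because i grows as the
      -- height falls.
      ≡⟨ cong (λ z → + z / 1) (sumBelow-extend (2 ℕ.* k) (suc d) p (λ h d<h → prefixes-zero N h k
           (subst (N <_) (ℕₚ.+-comm (2 ℕ.* k) h) (ℕₚ.+-monoʳ-< (2 ℕ.* k) d<h)))) ⟩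
    + sumBelow (suc d) p / 1
      ≡⟨ cong (λ z → + z / 1) (sym (sumBelow-reverse d p)) ⟩
    + sumBelow (suc d) (λ j → p (d ∸ j)) / 1
      ≡⟨ sym (sum-upTo (suc d) id (λ j → term N (2 ℕ.* k ℕ.+ j)) (λ j → p (d ∸ j))
           (λ j j<d → thagCoeff-term k d j (ℕₚ.≤-pred j<d))) ⟩
    List.foldr ℚ._+_ ℚ.0ℚ (List.map (λ j → term N (2 ℕ.* k ℕ.+ j)) (List.upTo (suc d)))
      ≡⟨ cong (λ m → List.foldr ℚ._+_ ℚ.0ℚ (List.map (λ j → term N (2 ℕ.* k ℕ.+ j)) (List.upTo m)))
           (sym (trans (cong (_∸ 2 ℕ.* k) (sym (ℕₚ.+-suc (2 ℕ.* k) d))) (ℕₚ.m+n∸m≡n (2 ℕ.* k) (suc d)))) ⟩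
    sum N ∎
    where
    open ≡-Reasoning
    N = 2 ℕ.* k ℕ.+ d
    p : ℕ → ℕ
    p h = prefixes N h k

-- Products with linear factors.

sumTo-cong : ∀ k {f g : ℕ → ℤ} → (∀ i → i ≤ k → f i ≡ g i) → sumTo k f ≡ sumTo k g
sumTo-cong zero eq = eq 0 z≤n
sumTo-cong (suc k) eq = cong₂ ℤ._+_ (sumTo-cong k (λ i i≤k → eq i (ℕₚ.m≤n⇒m≤1+n i≤k))) (eq (suc k) ℕₚ.≤-refl)

sumTo-zero : ∀ k → sumTo k (λ _ → 0ℤ) ≡ 0ℤ
sumTo-zero zero = refl
sumTo-zero (suc k) = trans (ℤₚ.+-identityʳ _) (sumTo-zero k)

sumTo-lin : ∀ k a f g → sumTo k (λ i → f i ℤ.- a ℤ.* g i) ≡ sumTo k f ℤ.- a ℤ.* sumTo k g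
sumTo-lin zero a f g = refl
sumTo-lin (suc k) a f g = trans (cong (ℤ._+ (f (suc k) ℤ.- a ℤ.* g (suc k))) (sumTo-lin k a f g)) (ring a (sumTo k f) (sumTo k g) (f (suc k)) (g (suc k)))
  where
  ring : ∀ a x y z w → (x ℤ.- a ℤ.* y) ℤ.+ (z ℤ.- a ℤ.* w) ≡ (x ℤ.+ z) ℤ.- a ℤ.* (y ℤ.+ w)
  ring = solve-∀

⊛-cong : ∀ {p p′ q q′ : Poly} → p ≗ p′ → q ≗ q′ → (p ⊛ q) ≗ (p′ ⊛ q′)
⊛-cong p≗ q≗ k = sumTo-cong k (λ i _ → cong₂ ℤ._*_ (p≗ i) (q≗ (k ∸ i)))

⊛-identityʳ : ∀ p → (p ⊛ 1P) ≗ p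
⊛-identityʳ p zero = ℤₚ.*-identityʳ (p 0)
⊛-identityʳ p (suc k) = begin
  sumTo k (λ i → p i ℤ.* 1P (suc k ∸ i)) ℤ.+ p (suc k) ℤ.* 1P (k ∸ k)
    ≡⟨ cong₂ (λ a b → a ℤ.+ p (suc k) ℤ.* 1P b)
         (trans (sumTo-cong k (λ i i≤k → trans (cong (λ m → p i ℤ.* 1P m) (ℕₚ.+-∸-assoc 1 i≤k)) (ℤₚ.*-zeroʳ (p i))))
           (sumTo-zero k))
         (ℕₚ.n∸n≡0 k) ⟩
  0ℤ ℤ.+ p (suc k) ℤ.* 1ℤ
    ≡⟨ trans (ℤₚ.+-identityˡ _) (ℤₚ.*-identityʳ _) ⟩
  p (suc k) ∎
  where open ≡-Reasoning

⊛-shift : ∀ p q → (p ⊛ shift q) ≗ shift (p ⊛ q)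
⊛-shift p q zero = ℤₚ.*-zeroʳ (p 0)
⊛-shift p q (suc k) = begin
  sumTo k (λ i → p i ℤ.* shift q (suc k ∸ i)) ℤ.+ p (suc k) ℤ.* shift q (k ∸ k)
    ≡⟨ cong₂ (λ a b → a ℤ.+ p (suc k) ℤ.* shift q b)
         (sumTo-cong k (λ i i≤k → cong (λ m → p i ℤ.* shift q m) (ℕₚ.+-∸-assoc 1 i≤k)))
         (ℕₚ.n∸n≡0 k) ⟩
  (p ⊛ q) k ℤ.+ p (suc k) ℤ.* 0ℤ
    ≡⟨ trans (cong (ℤ._+_ ((p ⊛ q) k)) (ℤₚ.*-zeroʳ (p (suc k)))) (ℤₚ.+-identityʳ _) ⟩
  (p ⊛ q) k ∎
  where open ≡-Reasoning

⊛-linMul : ∀ a p q → (p ⊛ linMul a q) ≗ linMul a (p ⊛ q)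
⊛-linMul a p q k = begin
  sumTo k (λ i → p i ℤ.* (q (k ∸ i) ℤ.- a ℤ.* shift q (k ∸ i)))
    ≡⟨ sumTo-cong k (λ i _ → ring (p i) a (q (k ∸ i)) (shift q (k ∸ i))) ⟩
  sumTo k (λ i → p i ℤ.* q (k ∸ i) ℤ.- a ℤ.* (p i ℤ.* shift q (k ∸ i)))
    ≡⟨ sumTo-lin k a _ _ ⟩
  (p ⊛ q) k ℤ.- a ℤ.* (p ⊛ shift q) k
    ≡⟨ cong (λ z → (p ⊛ q) k ℤ.- a ℤ.* z) (⊛-shift p q k) ⟩
  linMul a (p ⊛ q) k ∎
  where
  open ≡-Reasoning
  ring : ∀ p a x y → p ℤ.* (x ℤ.- a ℤ.* y) ≡ p ℤ.* x ℤ.- a ℤ.* (p ℤ.* y)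
  ring = solve-∀

-- All reversed characteristic polynomials of the contractions at flats turn out to be products of
-- factors 1 - a t, so the convolutions in the defining identity become iterations of `linMul`.
⊛-iter-linMul : ∀ a n p → (p ⊛ iter n (linMul a) 1P) ≗ iter n (linMul a) p
⊛-iter-linMul a zero p = ⊛-identityʳ p
⊛-iter-linMul a (suc n) p k =
  trans (⊛-linMul a p (iter n (linMul a) 1P) k) (linMul-cong a (⊛-iter-linMul a n p) k)

⊛-1P-linMul-iter : ∀ n → (1P ⊛ linMul 1ℤ (iter n (linMul (+ 2)) 1P)) ≗ linMul 1ℤ (iter n (linMul (+ 2)) 1P)
⊛-1P-linMul-iter n k =
  trans (⊛-linMul 1ℤ 1P (iter n (linMul (+ 2)) 1P) k) (linMul-cong 1ℤ (⊛-iter-linMul (+ 2) n 1P) k)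

-- Sums over subsets and over flats.

-- The sum follows the recursion of E instead of filtering a list of all subsets, so that it can be
-- split one element, and later one vertex, at a time.
sumSub : ∀ {m} → SubsetF m → (SubsetF m → ℤ) → ℤ
sumSub [] f = f []
sumSub (false ∷ E) f = sumSub E (λ S → f (false ∷ S))
sumSub (true ∷ E) f = sumSub E (λ S → f (false ∷ S)) ℤ.+ sumSub E (λ S → f (true ∷ S))

sumSub-cong-⊆ : ∀ {m} (E : SubsetF m) {f g : SubsetF m → ℤ} →
  (∀ S → (S ⊆ᵇ E) ≡ true → f S ≡ g S) → sumSub E f ≡ sumSub E g
sumSub-cong-⊆ [] eq = eq [] refl
sumSub-cong-⊆ (false ∷ E) eq = sumSub-cong-⊆ E (λ S → eq (false ∷ S))
sumSub-cong-⊆ (true ∷ E) eq =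
  cong₂ ℤ._+_ (sumSub-cong-⊆ E (λ S → eq (false ∷ S))) (sumSub-cong-⊆ E (λ S → eq (true ∷ S)))

sumSub-cong : ∀ {m} (E : SubsetF m) {f g : SubsetF m → ℤ} → (∀ S → f S ≡ g S) → sumSub E f ≡ sumSub E g
sumSub-cong E eq = sumSub-cong-⊆ E (λ S _ → eq S)

sumSub-zero : ∀ {m} (E : SubsetF m) → sumSub E (λ _ → 0ℤ) ≡ 0ℤ
sumSub-zero [] = refl
sumSub-zero (false ∷ E) = sumSub-zero E
sumSub-zero (true ∷ E) = cong₂ ℤ._+_ (sumSub-zero E) (sumSub-zero E)

sumSub-lin : ∀ {m} (E : SubsetF m) a b f g →
  sumSub E (λ S → a ℤ.* f S ℤ.+ b ℤ.* g S) ≡ a ℤ.* sumSub E f ℤ.+ b ℤ.* sumSub E g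
sumSub-lin [] a b f g = refl
sumSub-lin (false ∷ E) a b f g = sumSub-lin E a b _ _
sumSub-lin (true ∷ E) a b f g =
  trans (cong₂ ℤ._+_ (sumSub-lin E a b _ _) (sumSub-lin E a b _ _))
    (ring a b (sumSub E (λ S → f (false ∷ S))) (sumSub E (λ S → f (true ∷ S)))
      (sumSub E (λ S → g (false ∷ S))) (sumSub E (λ S → g (true ∷ S))))
  where
  ring : ∀ a b x x′ y y′ → (a ℤ.* x ℤ.+ b ℤ.* y) ℤ.+ (a ℤ.* x′ ℤ.+ b ℤ.* y′) ≡ a ℤ.* (x ℤ.+ x′) ℤ.+ b ℤ.* (y ℤ.+ y′)
  ring = solve-∀

sumSub-+ : ∀ {m} (E : SubsetF m) f g → sumSub E (λ S → f S ℤ.+ g S) ≡ sumSub E f ℤ.+ sumSub E g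
sumSub-+ [] f g = refl
sumSub-+ (false ∷ E) f g = sumSub-+ E _ _
sumSub-+ (true ∷ E) f g =
  trans (cong₂ ℤ._+_ (sumSub-+ E _ _) (sumSub-+ E _ _))
    (ring (sumSub E (λ S → f (false ∷ S))) (sumSub E (λ S → f (true ∷ S)))
      (sumSub E (λ S → g (false ∷ S))) (sumSub E (λ S → g (true ∷ S))))
  where
  ring : ∀ x x′ y y′ → (x ℤ.+ y) ℤ.+ (x′ ℤ.+ y′) ≡ (x ℤ.+ x′) ℤ.+ (y ℤ.+ y′)
  ring = solve-∀

==ₛ-refl : ∀ {m} (E : SubsetF m) → (E ==ₛ E) ≡ true
==ₛ-refl [] = refl
==ₛ-refl (false ∷ E) = ==ₛ-refl E
==ₛ-refl (true ∷ E) = ==ₛ-refl E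

sumSub-top : ∀ {m} (E : SubsetF m) f →
  sumSub E f ≡ sumSub E (λ F → if not (F ==ₛ E) then f F else 0ℤ) ℤ.+ f E
sumSub-top [] f = sym (ℤₚ.+-identityˡ (f []))
sumSub-top (false ∷ E) f = sumSub-top E (λ S → f (false ∷ S))
sumSub-top (true ∷ E) f = begin
  sumSub E f₀ ℤ.+ sumSub E f₁
    ≡⟨ cong₂ ℤ._+_ (sumSub-cong E (λ F → sym (cong (λ b → if not b then f₀ F else 0ℤ) (Boolₚ.∧-zeroʳ (F ⊆ᵇ E)))))
         (sumSub-top E f₁) ⟩
  A ℤ.+ (B ℤ.+ f (true ∷ E))
    ≡⟨ sym (ℤₚ.+-assoc A B (f (true ∷ E))) ⟩
  A ℤ.+ B ℤ.+ f (true ∷ E) ∎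
  where
  open ≡-Reasoning
  f₀ = λ S → f (false ∷ S)
  f₁ = λ S → f (true ∷ S)
  A = sumSub E (λ F → if not ((false ∷ F) ==ₛ (true ∷ E)) then f₀ F else 0ℤ)
  B = sumSub E (λ F → if not ((true ∷ F) ==ₛ (true ∷ E)) then f₁ F else 0ℤ)

sumSub-++ : ∀ {m n} (X : SubsetF m) (Y : SubsetF n) f →
  sumSub (X ++ Y) f ≡ sumSub X (λ u → sumSub Y (λ v → f (u ++ v)))
sumSub-++ [] Y f = refl
sumSub-++ (false ∷ X) Y f = sumSub-++ X Y _
sumSub-++ (true ∷ X) Y f = cong₂ ℤ._+_ (sumSub-++ X Y _) (sumSub-++ X Y _)

sumList : {A : Set} → List A → (A → ℤ) → ℤ
sumList [] f = 0ℤ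
sumList (x ∷ xs) f = f x ℤ.+ sumList xs f

sumList-++ : ∀ {A : Set} (xs ys : List A) f → sumList (xs List.++ ys) f ≡ sumList xs f ℤ.+ sumList ys f
sumList-++ [] ys f = sym (ℤₚ.+-identityˡ _)
sumList-++ (x ∷ xs) ys f = trans (cong (ℤ._+_ (f x)) (sumList-++ xs ys f)) (sym (ℤₚ.+-assoc (f x) _ _))

sumList-map : ∀ {A B : Set} (g : A → B) xs f → sumList (List.map g xs) f ≡ sumList xs (f ∘ g)
sumList-map g [] f = refl
sumList-map g (x ∷ xs) f = cong (ℤ._+_ (f (g x))) (sumList-map g xs f)

sumList-zero : ∀ {A : Set} (xs : List A) → sumList xs (λ _ → 0ℤ) ≡ 0ℤ
sumList-zero [] = refl
sumList-zero (x ∷ xs) = trans (ℤₚ.+-identityˡ _) (sumList-zero xs)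

sumList-filter : ∀ {A : Set} (p : A → Bool) xs (f : A → ℤ) →
  sumList (List.filter (Boolₚ.T? ∘ p) xs) f ≡ sumList xs (λ x → if p x then f x else 0ℤ)
sumList-filter p [] f = refl
sumList-filter p (x ∷ xs) f with p x
... | false = trans (sumList-filter p xs f) (sym (ℤₚ.+-identityˡ _))
... | true = cong (ℤ._+_ (f x)) (sumList-filter p xs f)

sumP-sumList : ∀ {A : Set} (xs : List A) f k → sumP xs f k ≡ sumList xs (λ x → f x k)
sumP-sumList [] f k = refl
sumP-sumList (x ∷ xs) f k = cong (ℤ._+_ (f x k)) (sumP-sumList xs f k)

sumList-allSubsets : ∀ {m} (E : SubsetF m) f →
  sumList (allSubsets m) (λ S → if S ⊆ᵇ E then f S else 0ℤ) ≡ sumSub E f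
sumList-allSubsets [] f = ℤₚ.+-identityʳ (f [])
sumList-allSubsets {suc m} (b ∷ E) f = begin
  sumList (List.map (false ∷_) (allSubsets m) List.++ List.map (true ∷_) (allSubsets m)) g
    ≡⟨ sumList-++ (List.map (false ∷_) (allSubsets m)) _ g ⟩
  sumList (List.map (false ∷_) (allSubsets m)) g ℤ.+ sumList (List.map (true ∷_) (allSubsets m)) g
    ≡⟨ cong₂ ℤ._+_ (trans (sumList-map (false ∷_) (allSubsets m) g) (sumList-allSubsets E (λ S → f (false ∷ S))))
         (sumList-map (true ∷_) (allSubsets m) g) ⟩
  sumSub E (λ S → f (false ∷ S)) ℤ.+ sumList (allSubsets m) (λ S → g (true ∷ S))
    ≡⟨ last b ⟩
  sumSub (b ∷ E) f ∎
  where
  open ≡-Reasoning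
  g = λ S → if S ⊆ᵇ (b ∷ E) then f S else 0ℤ
  last : ∀ b → sumSub E (λ S → f (false ∷ S)) ℤ.+
      sumList (allSubsets m) (λ S → if (true ∷ S) ⊆ᵇ (b ∷ E) then f (true ∷ S) else 0ℤ) ≡ sumSub (b ∷ E) f
  last false = trans (cong (ℤ._+_ (sumSub E (λ S → f (false ∷ S)))) (sumList-zero (allSubsets m))) (ℤₚ.+-identityʳ _)
  last true = cong (ℤ._+_ (sumSub E (λ S → f (false ∷ S)))) (sumList-allSubsets E (λ S → f (true ∷ S)))

sumP-subsetsOf : ∀ {m} (M : Matroid m) f k → sumP (subsetsOf M) f k ≡ sumSub (E M) (λ S → f S k)
sumP-subsetsOf {m} M f k =
  trans (sumP-sumList (subsetsOf M) f k)
    (trans (sumList-filter (_⊆ᵇ E M) (allSubsets m) (λ S → f S k)) (sumList-allSubsets (E M) (λ S → f S k)))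

-- `isFlat` without the inclusion in E, which `sumSub` supplies.
isClosed : ∀ {m} → Matroid m → SubsetF m → Bool
isClosed {m} M F = List.foldr _∧_ true
  (List.map (λ e → not (lookup (E M) e ∧ not (lookup F e)) ∨ not (rk M (F ∪ₛ single e) ≡ᵇ rk M F)) (allFin m))

sumP-properFlats : ∀ {m} (M : Matroid m) f k →
  sumP (List.filter (λ F → Boolₚ.T? (not (F ==ₛ E M))) (flats M)) f k ≡
    sumSub (E M) (λ F → if not (F ==ₛ E M) then (if isClosed M F then f F k else 0ℤ) else 0ℤ)
sumP-properFlats {m} M f k = begin
  sumP (List.filter (λ F → Boolₚ.T? (not (F ==ₛ E M))) (flats M)) f k
    ≡⟨ sumP-sumList (List.filter (λ F → Boolₚ.T? (not (F ==ₛ E M))) (flats M)) f k ⟩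
  sumList (List.filter (λ F → Boolₚ.T? (not (F ==ₛ E M))) (flats M)) (λ F → f F k)
    ≡⟨ sumList-filter (λ F → not (F ==ₛ E M)) (flats M) (λ F → f F k) ⟩
  sumList (flats M) (λ F → if not (F ==ₛ E M) then f F k else 0ℤ)
    ≡⟨ sumList-filter (isFlat M) (allSubsets m) _ ⟩
  sumList (allSubsets m) (λ F → if isFlat M F then (if not (F ==ₛ E M) then f F k else 0ℤ) else 0ℤ)
    ≡⟨ sumList-cong (allSubsets m) (λ F → swap (F ⊆ᵇ E M) (isClosed M F) (not (F ==ₛ E M)) (f F k)) ⟩
  sumList (allSubsets m) (λ F → if F ⊆ᵇ E M then
      (if not (F ==ₛ E M) then (if isClosed M F then f F k else 0ℤ) else 0ℤ) else 0ℤ)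
    ≡⟨ sumList-allSubsets (E M) _ ⟩
  sumSub (E M) (λ F → if not (F ==ₛ E M) then (if isClosed M F then f F k else 0ℤ) else 0ℤ) ∎
  where
  open ≡-Reasoning
  sumList-cong : ∀ {A : Set} (xs : List A) {f g : A → ℤ} → (∀ x → f x ≡ g x) → sumList xs f ≡ sumList xs g
  sumList-cong [] eq = refl
  sumList-cong (x ∷ xs) eq = cong₂ ℤ._+_ (eq x) (sumList-cong xs eq)
  swap : ∀ a b c z → (if a ∧ b then (if c then z else 0ℤ) else 0ℤ) ≡
    (if a then (if c then (if b then z else 0ℤ) else 0ℤ) else 0ℤ)
  swap false b c z = refl
  swap true false false z = refl
  swap true false true z = refl
  swap true true c z = refl

-- Uniqueness of the inverse Kazhdan-Lusztig polynomial.

revχ : ∀ {m} → Matroid m → SubsetF m → Poly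
revχ M F = revP (rank (contract M F)) (charPoly (contract M F))

invKLfuel-pos : ∀ {m} f (M : Matroid m) r k → rank M ≡ suc r →
  invKLfuel (suc f) M k ≡
    (if (k ℕ.+ k) ℕ.<ᵇ suc r
     then ℤ.- (sign (suc r) ℤ.* sumP (List.filter (λ F → Boolₚ.T? (not (F ==ₛ E M))) (flats M))
                 (λ F → scaleP (sign (rk M F)) (invKLfuel f (restrict M F) ⊛ revχ M F)) k)
     else 0ℤ)
invKLfuel-pos f M r k eq with rank M | eq
... | _ | refl = refl

invKLfuel-zero : ∀ {m} f (M : Matroid m) k → rank M ≡ 0 → invKLfuel f M k ≡ 1P k
invKLfuel-zero zero M k eq = refl
invKLfuel-zero (suc f) M k eq with rank M | eq
... | _ | refl = refl

sign-sq : ∀ r z → ℤ.- (sign r ℤ.* (ℤ.- (sign r ℤ.* z))) ≡ z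
sign-sq zero z = ring z
  where
  ring : ∀ z → ℤ.- (1ℤ ℤ.* (ℤ.- (1ℤ ℤ.* z))) ≡ z
  ring = solve-∀
sign-sq (suc r) z = trans (ring (sign r) z) (sign-sq r z)
  where
  ring : ∀ s z → ℤ.- (ℤ.- s ℤ.* (ℤ.- (ℤ.- s ℤ.* z))) ≡ ℤ.- (s ℤ.* (ℤ.- (s ℤ.* z)))
  ring = solve-∀

-- If deg Q is below half the rank, the left side of the defining identity has only terms of degree
-- above half the rank. In the lower degrees the identity thus says that the sum over all flats, E
-- included, vanishes. The term of E is the sign times Q(E), as its reversed characteristic
-- polynomial is 1, and solving for it gives the recursion. Q is a candidate for all flats at once,
-- so that the induction hypothesis covers the proper ones.
invKLfuel-unique : ∀ {m} f (M : Matroid m) r (Q : SubsetF m → Poly) → rank M ≡ suc r →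
  (∀ F → (F ⊆ᵇ E M) ≡ true → isClosed M F ≡ true → (F ==ₛ E M) ≡ false → invKLfuel f (restrict M F) ≗ Q F) →
  isClosed M (E M) ≡ true → revχ M (E M) ≗ 1P →
  (∀ k → suc r ≤ 2 ℕ.* k → Q (E M) k ≡ 0ℤ) →
  (∀ k → 2 ℕ.* k < suc r →
    sumSub (E M) (λ F → if isClosed M F then sign (rk M F) ℤ.* (Q F ⊛ revχ M F) k else 0ℤ) ≡ 0ℤ) →
  invKLfuel (suc f) M ≗ Q (E M)
invKLfuel-unique f M r Q rk≡ IH clE revE deg total k
  rewrite invKLfuel-pos f M r k rk≡ with (k ℕ.+ k) ℕ.<ᵇ suc r in eq
... | false = sym (deg k (ℕₚ.≮⇒≥ λ lt → subst T eq
  (ℕₚ.<⇒<ᵇ (subst (_< suc r) (cong (k ℕ.+_) (ℕₚ.+-identityʳ k)) lt))))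
... | true = begin
  ℤ.- (sign (suc r) ℤ.* sumP (List.filter (λ F → Boolₚ.T? (not (F ==ₛ E M))) (flats M))
                 (λ F → scaleP (sign (rk M F)) (invKLfuel f (restrict M F) ⊛ revχ M F)) k)
    ≡⟨ cong (λ z → ℤ.- (sign (suc r) ℤ.* z)) (trans (sumP-properFlats M _ k) (sumSub-cong-⊆ (E M) toQ)) ⟩
  ℤ.- (sign (suc r) ℤ.* R)
    ≡⟨ cong (λ z → ℤ.- (sign (suc r) ℤ.* z)) R≡ ⟩
  ℤ.- (sign (suc r) ℤ.* (ℤ.- (sign (suc r) ℤ.* Q (E M) k)))
    ≡⟨ sign-sq (suc r) (Q (E M) k) ⟩
  Q (E M) k ∎
  where
  open ≡-Reasoning
  g : SubsetF _ → ℤ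
  g F = if isClosed M F then sign (rk M F) ℤ.* (Q F ⊛ revχ M F) k else 0ℤ
  R : ℤ
  R = sumSub (E M) (λ F → if not (F ==ₛ E M) then g F else 0ℤ)
  toQ : ∀ F → (F ⊆ᵇ E M) ≡ true →
    (if not (F ==ₛ E M) then (if isClosed M F then scaleP (sign (rk M F)) (invKLfuel f (restrict M F) ⊛ revχ M F) k else 0ℤ) else 0ℤ) ≡
    (if not (F ==ₛ E M) then g F else 0ℤ)
  toQ F F⊆E with F ==ₛ E M in F≠E | isClosed M F in clF
  ... | true | _ = refl
  ... | false | false = refl
  ... | false | true = cong (sign (rk M F) ℤ.*_) (⊛-cong {q = revχ M F} (IH F F⊆E clF F≠E) (λ _ → refl) k)
  2k< : 2 ℕ.* k < suc r
  2k< = subst (_< suc r) (cong (k ℕ.+_) (sym (ℕₚ.+-identityʳ k))) (ℕₚ.<ᵇ⇒< (k ℕ.+ k) (suc r) (subst T (sym eq) tt))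
  gE : g (E M) ≡ sign (suc r) ℤ.* Q (E M) k
  gE rewrite clE | rk≡ = cong (sign (suc r) ℤ.*_)
    (trans (⊛-cong {p = Q (E M)} (λ _ → refl) revE k) (⊛-identityʳ (Q (E M)) k))
  cancel : ∀ x y → x ℤ.+ y ≡ 0ℤ → x ≡ ℤ.- y
  cancel x y e = trans (ring x y) (trans (cong (ℤ._- y) e) (ℤₚ.+-identityˡ _))
    where
    ring : ∀ x y → x ≡ x ℤ.+ y ℤ.- y
    ring = solve-∀
  R≡ : R ≡ ℤ.- (sign (suc r) ℤ.* Q (E M) k)
  R≡ = trans (cancel R (g (E M)) (trans (sym (sumSub-top (E M) g)) (total k 2k<))) (cong ℤ.-_ gE)

-- Closedness, and characteristic polynomials of contractions in general.

all-true : ∀ {A : Set} (p : A → Bool) xs → (∀ x → p x ≡ true) → List.foldr _∧_ true (List.map p xs) ≡ true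
all-true p [] all = refl
all-true p (x ∷ xs) all rewrite all x = all-true p xs all

all-false : ∀ {A : Set} (p : A → Bool) {xs x} → x ∈ xs → p x ≡ false → List.foldr _∧_ true (List.map p xs) ≡ false
all-false p (here refl) px rewrite px = refl
all-false p {y ∷ _} (there x∈) px rewrite all-false p x∈ px = Boolₚ.∧-zeroʳ (p y)

isClosed-true : ∀ {m} (M : Matroid m) F →
  (∀ e → lookup (E M) e ≡ true → lookup F e ≡ false → rk M (F ∪ₛ single e) ≢ rk M F) → isClosed M F ≡ true
isClosed-true {m} M F grows = all-true _ (allFin m) at
  where
  at : ∀ e → (not (lookup (E M) e ∧ not (lookup F e)) ∨ not (rk M (F ∪ₛ single e) ≡ᵇ rk M F)) ≡ true
  at e with lookup (E M) e in inE | lookup F e in inF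
  ... | false | _ = refl
  ... | true | true = refl
  ... | true | false rewrite ≢⇒≡ᵇ-false _ _ (grows e inE inF) = refl

isClosed-false : ∀ {m} (M : Matroid m) F e →
  lookup (E M) e ≡ true → lookup F e ≡ false → rk M (F ∪ₛ single e) ≡ rk M F → isClosed M F ≡ false
isClosed-false M F e inE inF same = all-false _ (∈-allFin e) at
  where
  at : (not (lookup (E M) e ∧ not (lookup F e)) ∨ not (rk M (F ∪ₛ single e) ≡ᵇ rk M F)) ≡ false
  at rewrite inE | inF | same | ≡ᵇ-refl (rk M F) = refl

isClosed-E : ∀ {m} (M : Matroid m) → isClosed M (E M) ≡ true
isClosed-E M = isClosed-true M (E M) λ e inE inF → contradiction (trans (sym inE) inF) λ ()

∪ₛ-false : ∀ {m} (S : SubsetF m) → S ∪ₛ tabulate (λ _ → false) ≡ S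
∪ₛ-false [] = refl
∪ₛ-false (s ∷ S) = cong₂ _∷_ (Boolₚ.∨-identityʳ s) (∪ₛ-false S)

∪ₛ-single : ∀ {m} (S : SubsetF m) e → S ∪ₛ single e ≡ S Vec.[ e ]≔ true
∪ₛ-single (s ∷ S) zero = cong₂ _∷_ (Boolₚ.∨-zeroʳ s) (∪ₛ-false S)
∪ₛ-single (s ∷ S) (suc e) = cong₂ _∷_ (Boolₚ.∨-identityʳ s) (∪ₛ-single S e)

⊆ᵇ-trans : ∀ {m} (S T U : SubsetF m) → (S ⊆ᵇ T) ≡ true → (T ⊆ᵇ U) ≡ true → (S ⊆ᵇ U) ≡ true
⊆ᵇ-trans [] [] [] _ _ = refl
⊆ᵇ-trans (false ∷ S) (false ∷ T) (u ∷ U) p q = ⊆ᵇ-trans S T U p q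
⊆ᵇ-trans (false ∷ S) (true ∷ T) (true ∷ U) p q = ⊆ᵇ-trans S T U p q
⊆ᵇ-trans (true ∷ S) (true ∷ T) (true ∷ U) p q = ⊆ᵇ-trans S T U p q

∪ₛ-mono : ∀ {m} (S T F : SubsetF m) → (S ⊆ᵇ T) ≡ true → ((S ∪ₛ F) ⊆ᵇ (T ∪ₛ F)) ≡ true
∪ₛ-mono [] [] [] _ = refl
∪ₛ-mono (false ∷ S) (false ∷ T) (false ∷ F) p = ∪ₛ-mono S T F p
∪ₛ-mono (false ∷ S) (false ∷ T) (true ∷ F) p = ∪ₛ-mono S T F p
∪ₛ-mono (false ∷ S) (true ∷ T) (false ∷ F) p = ∪ₛ-mono S T F p
∪ₛ-mono (false ∷ S) (true ∷ T) (true ∷ F) p = ∪ₛ-mono S T F p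
∪ₛ-mono (true ∷ S) (true ∷ T) (f ∷ F) p = ∪ₛ-mono S T F p

∖ₛ-∪ₛ : ∀ {m} (E F : SubsetF m) → (F ⊆ᵇ E) ≡ true → (E ∖ₛ F) ∪ₛ F ≡ E
∖ₛ-∪ₛ [] [] _ = refl
∖ₛ-∪ₛ (false ∷ E) (false ∷ F) p = cong (false ∷_) (∖ₛ-∪ₛ E F p)
∖ₛ-∪ₛ (true ∷ E) (false ∷ F) p = cong (true ∷_) (∖ₛ-∪ₛ E F p)
∖ₛ-∪ₛ (true ∷ E) (true ∷ F) p = cong (true ∷_) (∖ₛ-∪ₛ E F p)

⊆ᵇ-refl : ∀ {m} (E : SubsetF m) → (E ⊆ᵇ E) ≡ true
⊆ᵇ-refl [] = refl
⊆ᵇ-refl (false ∷ E) = ⊆ᵇ-refl E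
⊆ᵇ-refl (true ∷ E) = ⊆ᵇ-refl E

card-mono : ∀ {m} (S T : SubsetF m) → (S ⊆ᵇ T) ≡ true → card S ≤ card T
card-mono [] [] _ = z≤n
card-mono (false ∷ S) (false ∷ T) p = card-mono S T p
card-mono (false ∷ S) (true ∷ T) p = ℕₚ.m≤n⇒m≤1+n (card-mono S T p)
card-mono (true ∷ S) (true ∷ T) p = s≤s (card-mono S T p)

Monotone : ∀ {m} → Matroid m → Set
Monotone {m} M = ∀ (S T : SubsetF m) → (S ⊆ᵇ T) ≡ true → (T ⊆ᵇ E M) ≡ true → rk M S ≤ rk M T

mono-rev : ∀ c r d k → d ≤ r → (if k ℕ.≤ᵇ r then mono c (r ∸ d) (r ∸ k) else 0ℤ) ≡ mono c d k
mono-rev c r d k d≤r with k ℕ.≤ᵇ r in eq | d ℕₚ.≟ k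
... | true | yes refl rewrite ≡ᵇ-refl (r ∸ d) | ≡ᵇ-refl d = refl
... | true | no d≢k rewrite ≢⇒≡ᵇ-false d k d≢k
  | ≢⇒≡ᵇ-false (r ∸ d) (r ∸ k) (d≢k ∘ ℕₚ.∸-cancelˡ-≡ d≤r (ℕₚ.≤ᵇ⇒≤ k r (subst T (sym eq) tt))) = refl
... | false | no d≢k rewrite ≢⇒≡ᵇ-false d k d≢k = refl
... | false | yes refl = ⊥-elim (subst T eq (ℕₚ.≤⇒≤ᵇ d≤r))

-- Reversal exchanges corank for rank: t^{r-d} becomes t^d, where d is the rank of S in the
-- contraction. Monotonicity gives d ≤ r, without which the truncated subtraction in `charPoly`
-- could not be undone.
revχ-sum : ∀ {m} (M : Matroid m) F → Monotone M → (F ⊆ᵇ E M) ≡ true → ∀ k →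
  revχ M F k ≡ sumSub (E M ∖ₛ F) (λ S → mono (sign (card S)) (rk M (S ∪ₛ F) ∸ rk M F) k)
revχ-sum M F mon F⊆E k = begin
  (if k ℕ.≤ᵇ r then charPoly (contract M F) (r ∸ k) else 0ℤ)
    ≡⟨ cong (λ z → if k ℕ.≤ᵇ r then z else 0ℤ) (sumP-subsetsOf (contract M F) _ (r ∸ k)) ⟩
  (if k ℕ.≤ᵇ r then sumSub (E M ∖ₛ F) (λ S → mono (sign (card S)) (r ∸ d S) (r ∸ k)) else 0ℤ)
    ≡⟨ push (k ℕ.≤ᵇ r) ⟩
  sumSub (E M ∖ₛ F) (λ S → if k ℕ.≤ᵇ r then mono (sign (card S)) (r ∸ d S) (r ∸ k) else 0ℤ)
    ≡⟨ sumSub-cong-⊆ (E M ∖ₛ F) (λ S S⊆ → mono-rev (sign (card S)) r (d S) k (d≤r S S⊆)) ⟩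
  sumSub (E M ∖ₛ F) (λ S → mono (sign (card S)) (d S) k) ∎
  where
  open ≡-Reasoning
  r = rank (contract M F)
  d : SubsetF _ → ℕ
  d S = rk M (S ∪ₛ F) ∸ rk M F
  d≤r : ∀ S → (S ⊆ᵇ (E M ∖ₛ F)) ≡ true → d S ≤ r
  d≤r S S⊆ = ℕₚ.∸-monoˡ-≤ (rk M F) (mon (S ∪ₛ F) ((E M ∖ₛ F) ∪ₛ F) (∪ₛ-mono S (E M ∖ₛ F) F S⊆)
    (subst (λ X → (X ⊆ᵇ E M) ≡ true) (sym (∖ₛ-∪ₛ (E M) F F⊆E)) (⊆ᵇ-refl (E M))))
  push : ∀ b {f : SubsetF _ → ℤ} → (if b then sumSub (E M ∖ₛ F) f else 0ℤ) ≡ sumSub (E M ∖ₛ F) (λ S → if b then f S else 0ℤ)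
  push false = sym (sumSub-zero (E M ∖ₛ F))
  push true = refl

sumSub-∖-self : ∀ {m} (E : SubsetF m) f → sumSub (E ∖ₛ E) f ≡ f (E ∖ₛ E)
sumSub-∖-self [] f = refl
sumSub-∖-self (false ∷ E) f = sumSub-∖-self E _
sumSub-∖-self (true ∷ E) f = sumSub-∖-self E _

card-∖-self : ∀ {m} (E : SubsetF m) → card (E ∖ₛ E) ≡ 0
card-∖-self [] = refl
card-∖-self (false ∷ E) = card-∖-self E
card-∖-self (true ∷ E) = card-∖-self E

revχ-E : ∀ {m} (M : Matroid m) → Monotone M → revχ M (E M) ≗ 1P
revχ-E M mon k rewrite revχ-sum M (E M) mon (⊆ᵇ-refl (E M)) k
  | sumSub-∖-self (E M) (λ S → mono (sign (card S)) (rk M (S ∪ₛ E M) ∸ rk M (E M)) k)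
  | card-∖-self (E M) | ∖ₛ-∪ₛ (E M) (E M) (⊆ᵇ-refl (E M)) | ℕₚ.n∸n≡0 (rk M (E M)) = mono-1-0 k

sumSub-shift : ∀ {m} (E : SubsetF m) (p : SubsetF m → Poly) k →
  sumSub E (λ S → shift (p S) k) ≡ shift (λ i → sumSub E (λ S → p S i)) k
sumSub-shift E p zero = sumSub-zero E
sumSub-shift E p (suc k) = refl

sumSub-linMul : ∀ {m} (E : SubsetF m) a (p : SubsetF m → Poly) k →
  sumSub E (λ S → linMul a (p S) k) ≡ linMul a (λ i → sumSub E (λ S → p S i)) k
sumSub-linMul E a p k = begin
  sumSub E (λ S → p S k ℤ.- a ℤ.* shift (p S) k)
    ≡⟨ sumSub-cong E (λ S → ring a (p S k) (shift (p S) k)) ⟩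
  sumSub E (λ S → 1ℤ ℤ.* p S k ℤ.+ (ℤ.- a) ℤ.* shift (p S) k)
    ≡⟨ sumSub-lin E 1ℤ (ℤ.- a) _ _ ⟩
  1ℤ ℤ.* sumSub E (λ S → p S k) ℤ.+ (ℤ.- a) ℤ.* sumSub E (λ S → shift (p S) k)
    ≡⟨ sym (ring a (sumSub E (λ S → p S k)) (sumSub E (λ S → shift (p S) k))) ⟩
  sumSub E (λ S → p S k) ℤ.- a ℤ.* sumSub E (λ S → shift (p S) k)
    ≡⟨ cong (λ z → sumSub E (λ S → p S k) ℤ.- a ℤ.* z) (sumSub-shift E p k) ⟩
  linMul a (λ i → sumSub E (λ S → p S i)) k ∎
  where
  open ≡-Reasoning
  ring : ∀ a x y → x ℤ.- a ℤ.* y ≡ 1ℤ ℤ.* x ℤ.+ (ℤ.- a) ℤ.* y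
  ring = solve-∀

sumSub-neg : ∀ {m} (E : SubsetF m) f → sumSub E (λ S → ℤ.- f S) ≡ ℤ.- sumSub E f
sumSub-neg [] f = refl
sumSub-neg (false ∷ E) f = sumSub-neg E _
sumSub-neg (true ∷ E) f = trans (cong₂ ℤ._+_ (sumSub-neg E _) (sumSub-neg E _))
  (sym (ℤₚ.neg-distrib-+ (sumSub E (λ S → f (false ∷ S))) (sumSub E (λ S → f (true ∷ S)))))

mono-neg : ∀ c d k → mono (ℤ.- c) d k ≡ ℤ.- mono c d k
mono-neg c d k with d ≡ᵇ k
... | false = refl
... | true = refl

*-linMul : ∀ c a p k → c ℤ.* linMul a p k ≡ linMul a (λ i → c ℤ.* p i) k
*-linMul c a p zero = ring c a (p 0)
  where
  ring : ∀ c a x → c ℤ.* (x ℤ.- a ℤ.* 0ℤ) ≡ c ℤ.* x ℤ.- a ℤ.* 0ℤ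
  ring = solve-∀
*-linMul c a p (suc k) = ring c a (p (suc k)) (p k)
  where
  ring : ∀ c a x y → c ℤ.* (x ℤ.- a ℤ.* y) ≡ c ℤ.* x ℤ.- a ℤ.* (c ℤ.* y)
  ring = solve-∀

if-true : ∀ {A : Set} {b} {x y : A} → b ≡ true → (if b then x else y) ≡ x
if-true refl = refl

-- Boolean matroids

Boolean : ∀ {m} → Matroid m → Set
Boolean {m} M = ∀ (S : SubsetF m) → (S ⊆ᵇ E M) ≡ true → rk M S ≡ card S

Boolean-monotone : ∀ {m} (M : Matroid m) → Boolean M → Monotone M
Boolean-monotone M ind S T S⊆T T⊆E =
  subst₂ _≤_ (sym (ind S (⊆ᵇ-trans S T (E M) S⊆T T⊆E))) (sym (ind T T⊆E)) (card-mono S T S⊆T)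

card-insert : ∀ {m} (S : SubsetF m) e → lookup S e ≡ false → card (S Vec.[ e ]≔ true) ≡ suc (card S)
card-insert (false ∷ S) zero eq = refl
card-insert (false ∷ S) (suc e) eq = card-insert S e eq
card-insert (true ∷ S) (suc e) eq = cong suc (card-insert S e eq)

insert-⊆ : ∀ {m} (S E : SubsetF m) e → (S ⊆ᵇ E) ≡ true → lookup E e ≡ true → ((S Vec.[ e ]≔ true) ⊆ᵇ E) ≡ true
insert-⊆ (false ∷ S) (true ∷ E) zero S⊆E eq = S⊆E
insert-⊆ (true ∷ S) (true ∷ E) zero S⊆E eq = S⊆E
insert-⊆ (false ∷ S) (b ∷ E) (suc e) S⊆E eq = insert-⊆ S E e S⊆E eq
insert-⊆ (true ∷ S) (true ∷ E) (suc e) S⊆E eq = insert-⊆ S E e S⊆E eq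

card-∪-∖ : ∀ {m} (S E F : SubsetF m) → (S ⊆ᵇ (E ∖ₛ F)) ≡ true → card (S ∪ₛ F) ≡ card S ℕ.+ card F
card-∪-∖ [] [] [] _ = refl
card-∪-∖ (false ∷ S) (_ ∷ E) (false ∷ F) p = card-∪-∖ S E F (Boolₚ.∧-conicalʳ _ _ p)
card-∪-∖ (false ∷ S) (_ ∷ E) (true ∷ F) p =
  trans (cong suc (card-∪-∖ S E F p)) (sym (ℕₚ.+-suc (card S) (card F)))
card-∪-∖ (true ∷ S) (true ∷ E) (false ∷ F) p = cong suc (card-∪-∖ S E F p)
card-∪-∖ (true ∷ S) (true ∷ E) (true ∷ F) ()
card-∪-∖ (true ∷ S) (false ∷ E) (_ ∷ F) ()

sumSub-card : ∀ {m} (A : SubsetF m) k →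
  sumSub A (λ S → mono (sign (card S)) (card S) k) ≡ iter (card A) (linMul 1ℤ) 1P k
sumSub-card [] k = mono-1-0 k
sumSub-card (false ∷ A) k = sumSub-card A k
sumSub-card (true ∷ A) k = begin
  X k ℤ.+ sumSub A (λ S → mono (ℤ.- sign (card S)) (suc (card S)) k)
    ≡⟨ cong (ℤ._+_ (X k)) (sumSub-cong A (λ S → trans (mono-neg (sign (card S)) (suc (card S)) k)
         (cong ℤ.-_ (mono-suc (sign (card S)) (card S) k)))) ⟩
  X k ℤ.+ sumSub A (λ S → ℤ.- shift (mono (sign (card S)) (card S)) k)
    ≡⟨ cong (ℤ._+_ (X k)) (trans (sumSub-neg A _) (cong ℤ.-_ (sumSub-shift A _ k))) ⟩
  X k ℤ.- shift X k
    ≡⟨ cong (λ z → X k ℤ.- z) (sym (ℤₚ.*-identityˡ (shift X k))) ⟩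
  linMul 1ℤ X k
    ≡⟨ linMul-cong 1ℤ (sumSub-card A) k ⟩
  linMul 1ℤ (iter (card A) (linMul 1ℤ) 1P) k ∎
  where
  open ≡-Reasoning
  X : Poly
  X i = sumSub A (λ S → mono (sign (card S)) (card S) i)

Boolean-revχ : ∀ {m} (M : Matroid m) F → Boolean M → (F ⊆ᵇ E M) ≡ true →
  revχ M F ≗ iter (card (E M ∖ₛ F)) (linMul 1ℤ) 1P
Boolean-revχ M F ind F⊆E k =
  trans (revχ-sum M F (Boolean-monotone M ind) F⊆E k)
    (trans (sumSub-cong-⊆ (E M ∖ₛ F) (λ S S⊆ → cong (λ d → mono (sign (card S)) d k) (exponent S S⊆)))
      (sumSub-card (E M ∖ₛ F) k))
  where
  exponent : ∀ S → (S ⊆ᵇ (E M ∖ₛ F)) ≡ true → rk M (S ∪ₛ F) ∸ rk M F ≡ card S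
  exponent S S⊆ = trans
    (cong₂ _∸_ (trans (ind (S ∪ₛ F) (subst (λ X → ((S ∪ₛ F) ⊆ᵇ X) ≡ true) (∖ₛ-∪ₛ (E M) F F⊆E) (∪ₛ-mono S (E M ∖ₛ F) F S⊆)))
                 (card-∪-∖ S (E M) F S⊆)) (ind F F⊆E))
    (ℕₚ.m+n∸n≡m (card S) (card F))

negShift : Poly → Poly
negShift p k = ℤ.- shift p k

iter-negShift-low : ∀ n p k → k < n → iter n negShift p k ≡ 0ℤ
iter-negShift-low (suc n) p zero _ = refl
iter-negShift-low (suc n) p (suc k) (s≤s lt) = cong ℤ.-_ (iter-negShift-low n p k lt)

-- Each element contributes 1 - t if it is outside F and -1 if it is inside, in total -t. The sum is
-- (-t)^r, with no term of degree below r.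
Boolean-total : ∀ {m} (A : SubsetF m) k →
  sumSub A (λ F → sign (card F) ℤ.* iter (card (A ∖ₛ F)) (linMul 1ℤ) 1P k) ≡ iter (card A) negShift 1P k
Boolean-total [] k = ℤₚ.*-identityˡ (1P k)
Boolean-total (false ∷ A) k = Boolean-total A k
Boolean-total (true ∷ A) k = begin
  sumSub A (λ F → sign (card F) ℤ.* linMul 1ℤ (p F) k) ℤ.+ sumSub A (λ F → ℤ.- sign (card F) ℤ.* p F k)
    ≡⟨ cong₂ ℤ._+_
         (trans (sumSub-cong A (λ F → *-linMul (sign (card F)) 1ℤ (p F) k)) (sumSub-linMul A 1ℤ _ k))
         (trans (sumSub-cong A (λ F → sym (ℤₚ.neg-distribˡ-* (sign (card F)) (p F k)))) (sumSub-neg A _)) ⟩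
  linMul 1ℤ X k ℤ.- X k
    ≡⟨ ring (X k) (shift X k) ⟩
  negShift X k
    ≡⟨ cong ℤ.-_ (shift-cong (Boolean-total A) k) ⟩
  negShift (iter (card A) negShift 1P) k ∎
  where
  open ≡-Reasoning
  p : SubsetF _ → Poly
  p F = iter (card (A ∖ₛ F)) (linMul 1ℤ) 1P
  X : Poly
  X i = sumSub A (λ F → sign (card F) ℤ.* p F i)
  ring : ∀ x y → (x ℤ.- 1ℤ ℤ.* y) ℤ.- x ≡ ℤ.- y
  ring = solve-∀

Boolean-isClosed : ∀ {m} (M : Matroid m) F → Boolean M → (F ⊆ᵇ E M) ≡ true → isClosed M F ≡ true
Boolean-isClosed M F ind F⊆E = isClosed-true M F λ e inE inF same →
  ℕₚ.1+n≢n (trans (sym (card-insert F e inF))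
    (trans (sym (ind (F Vec.[ e ]≔ true) (insert-⊆ F (E M) e F⊆E inE)))
      (trans (cong (rk M) (sym (∪ₛ-single F e))) (trans same (ind F F⊆E)))))

-- Every subset is a flat, and the restrictions are again Boolean. The statement covers every amount
-- of fuel, since the default at exhausted fuel is also 1.
invKLfuel-Boolean : ∀ {m} f (M : Matroid m) → Boolean M → invKLfuel f M ≗ 1P
invKLfuel-Boolean zero M ind k = refl
invKLfuel-Boolean (suc f) M ind k = byRank (rank M) refl
  where
  deg : ∀ r k → suc r ≤ 2 ℕ.* k → 1P k ≡ 0ℤ
  deg r (suc k) _ = refl
  total : ∀ r → rank M ≡ suc r → ∀ k → 2 ℕ.* k < suc r →
    sumSub (E M) (λ F → if isClosed M F then sign (rk M F) ℤ.* (1P ⊛ revχ M F) k else 0ℤ) ≡ 0ℤ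
  total r rk≡ k lt = trans (sumSub-cong-⊆ (E M) at)
    (trans (Boolean-total (E M) k) (iter-negShift-low (card (E M)) 1P k
      (ℕₚ.<-≤-trans (ℕₚ.≤-<-trans (ℕₚ.m≤m+n k (k ℕ.+ 0)) lt)
        (ℕₚ.≤-reflexive (trans (sym rk≡) (ind (E M) (⊆ᵇ-refl (E M))))))))
    where
    at : ∀ F → (F ⊆ᵇ E M) ≡ true →
      (if isClosed M F then sign (rk M F) ℤ.* (1P ⊛ revχ M F) k else 0ℤ) ≡
      sign (card F) ℤ.* iter (card (E M ∖ₛ F)) (linMul 1ℤ) 1P k
    at F F⊆E = trans (if-true (Boolean-isClosed M F ind F⊆E))
      (cong₂ (λ d z → sign d ℤ.* z) (ind F F⊆E)
        (trans (⊛-cong {p = 1P} (λ _ → refl) (Boolean-revχ M F ind F⊆E) k)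
          (⊛-iter-linMul 1ℤ (card (E M ∖ₛ F)) 1P k)))
  byRank : ∀ r → rank M ≡ r → invKLfuel (suc f) M k ≡ 1P k
  byRank zero rk≡ = invKLfuel-zero (suc f) M k rk≡
  byRank (suc r) rk≡ = invKLfuel-unique f M r (λ _ → 1P) rk≡
    (λ F F⊆E _ _ → invKLfuel-Boolean f (restrict M F) (λ S S⊆F → ind S (⊆ᵇ-trans S F (E M) S⊆F F⊆E)))
    (isClosed-E M) (revχ-E M (Boolean-monotone M ind)) (deg r) (total r rk≡) k

-- Double sums over the edges at A and the edges at B.

if-false : ∀ {A : Set} {b} {x y : A} → b ≡ false → (if b then x else y) ≡ y
if-false refl = refl

sum2 : ∀ {m n} → SubsetF m → SubsetF n → (SubsetF m → SubsetF n → ℤ) → ℤ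
sum2 X Y g = sumSub X (λ u → sumSub Y (g u))

sum2-cong : ∀ {m n} (X : SubsetF m) (Y : SubsetF n) {f g : SubsetF m → SubsetF n → ℤ} →
  (∀ u v → f u v ≡ g u v) → sum2 X Y f ≡ sum2 X Y g
sum2-cong X Y eq = sumSub-cong X (λ u → sumSub-cong Y (eq u))

sum2-cong-⊆ : ∀ {m n} (X : SubsetF m) (Y : SubsetF n) {f g : SubsetF m → SubsetF n → ℤ} →
  (∀ u v → (u ⊆ᵇ X) ≡ true → (v ⊆ᵇ Y) ≡ true → f u v ≡ g u v) → sum2 X Y f ≡ sum2 X Y g
sum2-cong-⊆ X Y eq = sumSub-cong-⊆ X (λ u u⊆ → sumSub-cong-⊆ Y (λ v → eq u v u⊆))

sum2-zero : ∀ {m n} (X : SubsetF m) (Y : SubsetF n) → sum2 X Y (λ _ _ → 0ℤ) ≡ 0ℤ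
sum2-zero X Y = trans (sumSub-cong X (λ _ → sumSub-zero Y)) (sumSub-zero X)

sum2-+ : ∀ {m n} (X : SubsetF m) (Y : SubsetF n) f g →
  sum2 X Y (λ u v → f u v ℤ.+ g u v) ≡ sum2 X Y f ℤ.+ sum2 X Y g
sum2-+ X Y f g = trans (sumSub-cong X (λ u → sumSub-+ Y (f u) (g u))) (sumSub-+ X _ _)

sum2-neg : ∀ {m n} (X : SubsetF m) (Y : SubsetF n) f → sum2 X Y (λ u v → ℤ.- f u v) ≡ ℤ.- sum2 X Y f
sum2-neg X Y f = trans (sumSub-cong X (λ u → sumSub-neg Y (f u))) (sumSub-neg X _)

sum2-shift : ∀ {m n} (X : SubsetF m) (Y : SubsetF n) (p : SubsetF m → SubsetF n → Poly) k →
  sum2 X Y (λ u v → shift (p u v) k) ≡ shift (λ i → sum2 X Y (λ u v → p u v i)) k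
sum2-shift X Y p k = trans (sumSub-cong X (λ u → sumSub-shift Y (p u) k)) (sumSub-shift X _ k)

sum2-linMul : ∀ {m n} (X : SubsetF m) (Y : SubsetF n) a (p : SubsetF m → SubsetF n → Poly) k →
  sum2 X Y (λ u v → linMul a (p u v) k) ≡ linMul a (λ i → sum2 X Y (λ u v → p u v i)) k
sum2-linMul X Y a p k = trans (sumSub-cong X (λ u → sumSub-linMul Y a (p u) k)) (sumSub-linMul X a _ k)

choose : Bool → (Bool → ℤ) → ℤ
choose false f = f false
choose true f = f false ℤ.+ f true

-- Brings the choices for Aj and for Bj together, so that a vertex j contributes one factor made of
-- up to four choices.
sum2-cons : ∀ {m n} a b (X : SubsetF m) (Y : SubsetF n) g →
  sum2 (a ∷ X) (b ∷ Y) g ≡ choose a (λ a′ → choose b (λ b′ → sum2 X Y (λ u v → g (a′ ∷ u) (b′ ∷ v))))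
sum2-cons false false X Y g = refl
sum2-cons false true X Y g = sumSub-+ X _ _
sum2-cons true false X Y g = refl
sum2-cons true true X Y g = cong₂ ℤ._+_ (sumSub-+ X _ _) (sumSub-+ X _ _)

-- Characteristic polynomials of the contractions

-- The vertices covered by S = (u , v) but not by F = (x , y): the rank of S in the contraction by
-- F, up to the possible joining of A and B.
new : ∀ {n} → (x y u v : Vec Bool n) → ℕ
new [] [] [] [] = 0
new (a ∷ x) (b ∷ y) (c ∷ u) (d ∷ v) = bit ((c ∨ d) ∧ not (a ∨ b)) ℕ.+ new x y u v

cov-∪ : ∀ {n} (x y u v : Vec Bool n) → cov (u ∪ₛ x) (v ∪ₛ y) ≡ cov x y ℕ.+ new x y u v
cov-∪ [] [] [] [] = refl
cov-∪ (a ∷ x) (b ∷ y) (c ∷ u) (d ∷ v) = trans (cong₂ ℕ._+_ (head a b c d) (cov-∪ x y u v))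
  (arith (bit (a ∨ b)) (bit ((c ∨ d) ∧ not (a ∨ b))) (cov x y) (new x y u v))
  where
  head : ∀ a b c d → bit ((c ∨ a) ∨ (d ∨ b)) ≡ bit (a ∨ b) ℕ.+ bit ((c ∨ d) ∧ not (a ∨ b))
  head false false false false = refl
  head false false false true = refl
  head false false true d = refl
  head false true false false = refl
  head false true false true = refl
  head false true true false = refl
  head false true true true = refl
  head true b false false = refl
  head true b false true = refl
  head true b true false = refl
  head true b true true = refl
  arith : ∀ w x y z → (w ℕ.+ x) ℕ.+ (y ℕ.+ z) ≡ (w ℕ.+ y) ℕ.+ (x ℕ.+ z)
  arith = solveℕ-∀

weight : ∀ {n} (x y u v : Vec Bool n) → Poly
weight x y u v = mono (sign (card u ℕ.+ card v)) (new x y u v)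

mono-sign-suc : ∀ c d k → mono (sign (suc c)) (suc d) k ≡ ℤ.- shift (mono (sign c) d) k
mono-sign-suc c d k = trans (mono-neg (sign c) (suc d) k) (cong ℤ.-_ (mono-suc (sign c) d k))

weight-01 : ∀ {n} (x y u v : Vec Bool n) k →
  weight (false ∷ x) (false ∷ y) (false ∷ u) (true ∷ v) k ≡ ℤ.- shift (weight x y u v) k
weight-01 x y u v k rewrite ℕₚ.+-suc (card u) (card v) = mono-sign-suc (card u ℕ.+ card v) (new x y u v) k

weight-10 : ∀ {n} (x y u v : Vec Bool n) k →
  weight (false ∷ x) (false ∷ y) (true ∷ u) (false ∷ v) k ≡ ℤ.- shift (weight x y u v) k
weight-10 x y u v k = mono-sign-suc (card u ℕ.+ card v) (new x y u v) k

weight-11 : ∀ {n} (x y u v : Vec Bool n) k →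
  weight (false ∷ x) (false ∷ y) (true ∷ u) (true ∷ v) k ≡ shift (weight x y u v) k
weight-11 x y u v k rewrite ℕₚ.+-suc (card u) (card v) = trans
  (cong (λ s → mono s (suc (new x y u v)) k) (ℤₚ.neg-involutive (sign (card u ℕ.+ card v))))
  (mono-suc (sign (card u ℕ.+ card v)) (new x y u v) k)

-- Once AB is contracted, Aj and Bj are parallel. Taking neither, one, the other or both gives 1 - t
-- - t + t = 1 - t, the factor of a single element.
sum2-weight : ∀ {n} (J x : Vec Bool n) k →
  sum2 (J ∖ₛ x) (J ∖ₛ x) (λ u v → weight x x u v k) ≡ iter (card (J ∖ₛ x)) (linMul 1ℤ) 1P k
sum2-weight [] [] k = mono-1-0 k
sum2-weight (false ∷ J) (a ∷ x) k = sum2-weight J x k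
sum2-weight (true ∷ J) (true ∷ x) k = sum2-weight J x k
sum2-weight (true ∷ J) (false ∷ x) k = begin
  sum2 (true ∷ A) (true ∷ A) (λ u v → weight (false ∷ x) (false ∷ x) u v k)
    ≡⟨ sum2-cons true true A A (λ u v → weight (false ∷ x) (false ∷ x) u v k) ⟩
  (X k ℤ.+ sum2 A A (λ u v → weight (false ∷ x) (false ∷ x) (false ∷ u) (true ∷ v) k)) ℤ.+
  (sum2 A A (λ u v → weight (false ∷ x) (false ∷ x) (true ∷ u) (false ∷ v) k) ℤ.+
   sum2 A A (λ u v → weight (false ∷ x) (false ∷ x) (true ∷ u) (true ∷ v) k))
    ≡⟨ cong₂ (λ a b → (X k ℤ.+ a) ℤ.+ b) (minus (weight-01 x x))
         (cong₂ ℤ._+_ (minus (weight-10 x x))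
           (trans (sum2-cong A A (λ u v → weight-11 x x u v k)) (sum2-shift A A (weight x x) k))) ⟩
  (X k ℤ.- shift X k) ℤ.+ (ℤ.- shift X k ℤ.+ shift X k)
    ≡⟨ ring (X k) (shift X k) ⟩
  linMul 1ℤ X k
    ≡⟨ linMul-cong 1ℤ (sum2-weight J x) k ⟩
  linMul 1ℤ (iter (card A) (linMul 1ℤ) 1P) k ∎
  where
  open ≡-Reasoning
  A = J ∖ₛ x
  X : Poly
  X i = sum2 A A (λ u v → weight x x u v i)
  minus : {f : Vec Bool _ → Vec Bool _ → Poly} → (∀ u v k → f u v k ≡ ℤ.- shift (weight x x u v) k) →
    sum2 A A (λ u v → f u v k) ≡ ℤ.- shift X k
  minus eq = trans (sum2-cong A A (λ u v → eq u v k))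
    (trans (sum2-neg A A _) (cong ℤ.-_ (sum2-shift A A (weight x x) k)))
  ring : ∀ x y → (x ℤ.- y) ℤ.+ (ℤ.- y ℤ.+ y) ≡ x ℤ.- 1ℤ ℤ.* y
  ring = solve-∀

uncovered : ∀ {n} (J x y : Vec Bool n) → ℕ
uncovered [] [] [] = 0
uncovered (j ∷ J) (a ∷ x) (b ∷ y) = bit (j ∧ not (a ∨ b)) ℕ.+ uncovered J x y

unconnected : ∀ {n} (x y u v : Vec Bool n) → Poly
unconnected x y u v k = if conn (u ∪ₛ x) (v ∪ₛ y) then 0ℤ else weight x y u v k

if-neg-shift : ∀ b (p : Poly) k → (if b then 0ℤ else ℤ.- shift p k) ≡ ℤ.- shift (λ i → if b then 0ℤ else p i) k
if-neg-shift false p zero = refl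
if-neg-shift false p (suc k) = refl
if-neg-shift true p zero = refl
if-neg-shift true p (suc k) = refl

-- At a vertex uncovered by F the choice of both edges would join A and B, which leaves 1 - t - t =
-- 1 - 2t. At a vertex with one edge in F the other edge would join them, so that only the factor 1
-- remains.
sum2-unconnected : ∀ {n} (J x y : Vec Bool n) → conn x y ≡ false → ∀ k →
  sum2 (J ∖ₛ x) (J ∖ₛ y) (λ u v → unconnected x y u v k) ≡ iter (uncovered J x y) (linMul (+ 2)) 1P k
sum2-unconnected [] [] [] _ k = mono-1-0 k
sum2-unconnected (false ∷ J) (false ∷ x) (b ∷ y) dis k = sum2-unconnected J x y dis k
sum2-unconnected (false ∷ J) (true ∷ x) (false ∷ y) dis k = sum2-unconnected J x y dis k
sum2-unconnected (true ∷ J) (true ∷ x) (false ∷ y) dis k =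
  trans (sum2-cons false true (J ∖ₛ x) (J ∖ₛ y) (λ u v → unconnected (true ∷ x) (false ∷ y) u v k))
    (trans (cong₂ ℤ._+_ (sum2-unconnected J x y dis k) (sum2-zero (J ∖ₛ x) (J ∖ₛ y))) (ℤₚ.+-identityʳ _))
sum2-unconnected (true ∷ J) (false ∷ x) (true ∷ y) dis k =
  trans (sum2-cons true false (J ∖ₛ x) (J ∖ₛ y) (λ u v → unconnected (false ∷ x) (true ∷ y) u v k))
    (trans (cong₂ ℤ._+_ (sum2-unconnected J x y dis k) (sum2-zero (J ∖ₛ x) (J ∖ₛ y))) (ℤₚ.+-identityʳ _))
sum2-unconnected (true ∷ J) (false ∷ x) (false ∷ y) dis k = begin
  sum2 (true ∷ A) (true ∷ B) (λ u v → unconnected (false ∷ x) (false ∷ y) u v k)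
    ≡⟨ sum2-cons true true A B (λ u v → unconnected (false ∷ x) (false ∷ y) u v k) ⟩
  (X k ℤ.+ sum2 A B (λ u v → unconnected (false ∷ x) (false ∷ y) (false ∷ u) (true ∷ v) k)) ℤ.+
  (sum2 A B (λ u v → unconnected (false ∷ x) (false ∷ y) (true ∷ u) (false ∷ v) k) ℤ.+ sum2 A B (λ _ _ → 0ℤ))
    ≡⟨ cong₂ (λ a b → (X k ℤ.+ a) ℤ.+ b) (minus (weight-01 x y))
         (cong₂ ℤ._+_ (minus (weight-10 x y)) (sum2-zero A B)) ⟩
  (X k ℤ.- shift X k) ℤ.+ (ℤ.- shift X k ℤ.+ 0ℤ)
    ≡⟨ ring (X k) (shift X k) ⟩
  linMul (+ 2) X k
    ≡⟨ linMul-cong (+ 2) (sum2-unconnected J x y dis) k ⟩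
  linMul (+ 2) (iter (uncovered J x y) (linMul (+ 2)) 1P) k ∎
  where
  open ≡-Reasoning
  A = J ∖ₛ x
  B = J ∖ₛ y
  X : Poly
  X i = sum2 A B (λ u v → unconnected x y u v i)
  minus : {f : Vec Bool _ → Vec Bool _ → Poly} → (∀ u v k → f u v k ≡ ℤ.- shift (weight x y u v) k) →
    sum2 A B (λ u v → if conn (u ∪ₛ x) (v ∪ₛ y) then 0ℤ else f u v k) ≡ ℤ.- shift X k
  minus eq = trans
    (sum2-cong A B (λ u v → trans (cong (λ z → if conn (u ∪ₛ x) (v ∪ₛ y) then 0ℤ else z) (eq u v k))
      (if-neg-shift (conn (u ∪ₛ x) (v ∪ₛ y)) (weight x y u v) k)))
    (trans (sum2-neg A B _) (cong ℤ.-_ (sum2-shift A B (unconnected x y) k)))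
  ring : ∀ x y → (x ℤ.- y) ℤ.+ (ℤ.- y ℤ.+ 0ℤ) ≡ x ℤ.- + 2 ℤ.* y
  ring = solve-∀

-- Sums over the flats

if-*-linMul : ∀ b c a (p : Poly) k →
  (if b then c ℤ.* linMul a p k else 0ℤ) ≡ linMul a (λ i → if b then c ℤ.* p i else 0ℤ) k
if-*-linMul true c a p k = *-linMul c a p k
if-*-linMul false c a p zero = ring a
  where
  ring : ∀ a → 0ℤ ≡ 0ℤ ℤ.- a ℤ.* 0ℤ
  ring = solve-∀
if-*-linMul false c a p (suc k) = ring a
  where
  ring : ∀ a → 0ℤ ≡ 0ℤ ℤ.- a ℤ.* 0ℤ
  ring = solve-∀

if-neg-* : ∀ b c z → (if b then ℤ.- c ℤ.* z else 0ℤ) ≡ ℤ.- (if b then c ℤ.* z else 0ℤ)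
if-neg-* true c z = sym (ℤₚ.neg-distribˡ-* c z)
if-neg-* false c z = refl

-- A vertex without an edge in F leaves 1 - 2t, each of the two single edges gives -1, and both
-- edges together are excluded: in total -(1 + 2t).
sum2-forests : ∀ {n} (J : Vec Bool n) k →
  sum2 J J (λ x y → if not (conn x y) then sign (cov x y) ℤ.* iter (uncovered J x y) (linMul (+ 2)) 1P k else 0ℤ) ≡
    iter (card J) negMul 1P k
sum2-forests [] k = ℤₚ.*-identityˡ (1P k)
sum2-forests (false ∷ J) k = sum2-forests J k
sum2-forests (true ∷ J) k = begin
  sum2 (true ∷ J) (true ∷ J) g
    ≡⟨ sum2-cons true true J J g ⟩
  (sum2 J J (λ x y → if not (conn x y) then sign (cov x y) ℤ.* linMul (+ 2) (p x y) k else 0ℤ) ℤ.+ N) ℤ.+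
  (N ℤ.+ sum2 J J (λ _ _ → 0ℤ))
    ≡⟨ cong₂ (λ a b → (a ℤ.+ N) ℤ.+ (N ℤ.+ b))
         (trans (sum2-cong J J (λ x y → if-*-linMul (not (conn x y)) (sign (cov x y)) (+ 2) (p x y) k))
           (sum2-linMul J J (+ 2) _ k))
         (sum2-zero J J) ⟩
  (linMul (+ 2) X k ℤ.+ N) ℤ.+ (N ℤ.+ 0ℤ)
    ≡⟨ cong (λ z → (linMul (+ 2) X k ℤ.+ z) ℤ.+ (z ℤ.+ 0ℤ))
         (trans (sum2-cong J J (λ x y → if-neg-* (not (conn x y)) (sign (cov x y)) (p x y k))) (sum2-neg J J _)) ⟩
  (linMul (+ 2) X k ℤ.- X k) ℤ.+ (ℤ.- X k ℤ.+ 0ℤ)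
    ≡⟨ ring (X k) (shift X k) ⟩
  negMul X k
    ≡⟨ negMul-cong (sum2-forests J) k ⟩
  negMul (iter (card J) negMul 1P) k ∎
  where
  open ≡-Reasoning
  g : Vec Bool _ → Vec Bool _ → ℤ
  g x y = if not (conn x y) then sign (cov x y) ℤ.* iter (uncovered (true ∷ J) x y) (linMul (+ 2)) 1P k else 0ℤ
  p : Vec Bool _ → Vec Bool _ → Poly
  p x y = iter (uncovered J x y) (linMul (+ 2)) 1P
  X : Poly
  X i = sum2 J J (λ x y → if not (conn x y) then sign (cov x y) ℤ.* p x y i else 0ℤ)
  N : ℤ
  N = sum2 J J (λ x y → if not (conn x y) then ℤ.- sign (cov x y) ℤ.* p x y k else 0ℤ)
  ring : ∀ x y → ((x ℤ.- + 2 ℤ.* y) ℤ.- x) ℤ.+ (ℤ.- x ℤ.+ 0ℤ) ≡ ℤ.- x ℤ.- + 2 ℤ.* y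
  ring = solve-∀

eqv : ∀ {n} → Vec Bool n → Vec Bool n → Bool
eqv [] [] = true
eqv (a ∷ x) (b ∷ y) = (if a then b else not b) ∧ eqv x y

-- A vertex outside x gives the factor 1 - t, and a vertex inside x changes the sign and advances
-- the index of q, as in the recursion of `binT`. The induction needs q arbitrary, since it passes
-- to `q ∘ suc`.
sum2-diagonal : ∀ {n} (J : Vec Bool n) (q : ℕ → Poly) k →
  sum2 J J (λ x y → if eqv x y then sign (card x) ℤ.* iter (card (J ∖ₛ x)) (linMul 1ℤ) (q (card x)) k else 0ℤ) ≡
    binT (card J) q k
sum2-diagonal [] q k = ℤₚ.*-identityˡ (q 0 k)
sum2-diagonal (false ∷ J) q k = sum2-diagonal J q k
sum2-diagonal (true ∷ J) q k = begin
  sum2 (true ∷ J) (true ∷ J) g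
    ≡⟨ sum2-cons true true J J g ⟩
  (sum2 J J (λ x y → if eqv x y then sign (card x) ℤ.* linMul 1ℤ (p q x) k else 0ℤ) ℤ.+ sum2 J J (λ _ _ → 0ℤ)) ℤ.+
  (sum2 J J (λ _ _ → 0ℤ) ℤ.+ sum2 J J (λ x y → if eqv x y then ℤ.- sign (card x) ℤ.* p (q ∘ suc) x k else 0ℤ))
    ≡⟨ cong₂ (λ a b → (a ℤ.+ sum2 J J (λ _ _ → 0ℤ)) ℤ.+ (sum2 J J (λ _ _ → 0ℤ) ℤ.+ b))
         (trans (sum2-cong J J (λ x y → if-*-linMul (eqv x y) (sign (card x)) 1ℤ (p q x) k)) (sum2-linMul J J 1ℤ _ k))
         (trans (sum2-cong J J (λ x y → if-neg-* (eqv x y) (sign (card x)) (p (q ∘ suc) x k))) (sum2-neg J J _)) ⟩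
  (linMul 1ℤ (X q) k ℤ.+ sum2 J J (λ _ _ → 0ℤ)) ℤ.+ (sum2 J J (λ _ _ → 0ℤ) ℤ.- X (q ∘ suc) k)
    ≡⟨ cong (λ z → (linMul 1ℤ (X q) k ℤ.+ z) ℤ.+ (z ℤ.- X (q ∘ suc) k)) (sum2-zero J J) ⟩
  (linMul 1ℤ (X q) k ℤ.+ 0ℤ) ℤ.+ (0ℤ ℤ.- X (q ∘ suc) k)
    ≡⟨ cong₂ ℤ._+_ (ℤₚ.+-identityʳ (linMul 1ℤ (X q) k)) (ℤₚ.+-identityˡ (ℤ.- X (q ∘ suc) k)) ⟩
  linMul 1ℤ (X q) k ℤ.- X (q ∘ suc) k
    ≡⟨ cong₂ ℤ._-_ (linMul-cong 1ℤ (sum2-diagonal J q) k) (sum2-diagonal J (q ∘ suc) k) ⟩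
  linMul 1ℤ (binT (card J) q) k ℤ.- binT (card J) (q ∘ suc) k ∎
  where
  open ≡-Reasoning
  g : Vec Bool _ → Vec Bool _ → ℤ
  g x y = if eqv x y then sign (card x) ℤ.* iter (card ((true ∷ J) ∖ₛ x)) (linMul 1ℤ) (q (card x)) k else 0ℤ
  p : (ℕ → Poly) → Vec Bool _ → Poly
  p q x = iter (card (J ∖ₛ x)) (linMul 1ℤ) (q (card x))
  X : (ℕ → Poly) → Poly
  X q i = sum2 J J (λ x y → if eqv x y then sign (card x) ℤ.* p q x i else 0ℤ)

-- The flats of T_J.

conn-comm : ∀ {n} (x y : Vec Bool n) → conn x y ≡ conn y x
conn-comm [] [] = refl
conn-comm (a ∷ x) (b ∷ y) = cong₂ _∨_ (Boolₚ.∧-comm a b) (conn-comm x y)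

cov-comm : ∀ {n} (x y : Vec Bool n) → cov x y ≡ cov y x
cov-comm [] [] = refl
cov-comm (a ∷ x) (b ∷ y) = cong₂ (λ c d → bit c ℕ.+ d) (Boolₚ.∨-comm a b) (cov-comm x y)

cov-self : ∀ {n} (x : Vec Bool n) → cov x x ≡ card x
cov-self [] = refl
cov-self (false ∷ x) = cov-self x
cov-self (true ∷ x) = cong suc (cov-self x)

cov-disjoint : ∀ {n} (x y : Vec Bool n) → conn x y ≡ false → cov x y ≡ card x ℕ.+ card y
cov-disjoint [] [] _ = refl
cov-disjoint (false ∷ x) (false ∷ y) dis = cov-disjoint x y dis
cov-disjoint (false ∷ x) (true ∷ y) dis = trans (cong suc (cov-disjoint x y dis)) (sym (ℕₚ.+-suc (card x) (card y)))
cov-disjoint (true ∷ x) (false ∷ y) dis = cong suc (cov-disjoint x y dis)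

conn-mono : ∀ {n} (x y x′ y′ : Vec Bool n) → (x ⊆ᵇ x′) ≡ true → (y ⊆ᵇ y′) ≡ true →
  conn x y ≡ true → conn x′ y′ ≡ true
conn-mono [] [] [] [] _ _ ()
conn-mono (true ∷ x) (true ∷ y) (true ∷ x′) (true ∷ y′) p q c = refl
conn-mono (true ∷ x) (false ∷ y) (true ∷ x′) (false ∷ y′) p q c = conn-mono x y x′ y′ p q c
conn-mono (true ∷ x) (false ∷ y) (true ∷ x′) (true ∷ y′) p q c = refl
conn-mono (false ∷ x) (false ∷ y) (a ∷ x′) (b ∷ y′) p q c
  rewrite conn-mono x y x′ y′ p q c = Boolₚ.∨-zeroʳ (a ∧ b)
conn-mono (false ∷ x) (true ∷ y) (a ∷ x′) (true ∷ y′) p q c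
  rewrite conn-mono x y x′ y′ p q c = Boolₚ.∨-zeroʳ (a ∧ true)

cov-mono : ∀ {n} (x y x′ y′ : Vec Bool n) → (x ⊆ᵇ x′) ≡ true → (y ⊆ᵇ y′) ≡ true → cov x y ≤ cov x′ y′
cov-mono [] [] [] [] _ _ = z≤n
cov-mono (false ∷ x) (false ∷ y) (a ∷ x′) (b ∷ y′) p q =
  ℕₚ.≤-trans (cov-mono x y x′ y′ p q) (ℕₚ.m≤n+m _ (bit (a ∨ b)))
cov-mono (false ∷ x) (true ∷ y) (false ∷ x′) (true ∷ y′) p q = s≤s (cov-mono x y x′ y′ p q)
cov-mono (false ∷ x) (true ∷ y) (true ∷ x′) (true ∷ y′) p q = s≤s (cov-mono x y x′ y′ p q)
cov-mono (true ∷ x) (false ∷ y) (true ∷ x′) (b ∷ y′) p q = s≤s (cov-mono x y x′ y′ p q)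
cov-mono (true ∷ x) (true ∷ y) (true ∷ x′) (true ∷ y′) p q = s≤s (cov-mono x y x′ y′ p q)

bit-mono : ∀ {a b} → (a ≡ true → b ≡ true) → bit a ≤ bit b
bit-mono {false} _ = z≤n
bit-mono {true} a⇒b rewrite a⇒b refl = ℕₚ.≤-refl

∧-true : ∀ {a b} → (a ∧ b) ≡ true → a ≡ true × b ≡ true
∧-true {true} {true} _ = refl , refl

data Edges {n : ℕ} : SubsetF (suc (n ℕ.+ n)) → Set where
  mkEdges : ∀ b (x y : Vec Bool n) → Edges (edges b x y)

toEdges : ∀ {n} (S : SubsetF (suc (n ℕ.+ n))) → Edges {n} S
toEdges {n} (b ∷ S) with Vec.splitAt n S
... | x , y , refl = mkEdges b x y

++-⊆ : ∀ {m n} (x x′ : SubsetF m) (y y′ : SubsetF n) → ((x ++ y) ⊆ᵇ (x′ ++ y′)) ≡ ((x ⊆ᵇ x′) ∧ (y ⊆ᵇ y′))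
++-⊆ [] [] y y′ = refl
++-⊆ (a ∷ x) (b ∷ x′) y y′ =
  trans (cong ((not a ∨ b) ∧_) (++-⊆ x x′ y y′)) (sym (Boolₚ.∧-assoc (not a ∨ b) (x ⊆ᵇ x′) (y ⊆ᵇ y′)))

card-++ : ∀ {m n} (x : SubsetF m) (y : SubsetF n) → card (x ++ y) ≡ card x ℕ.+ card y
card-++ [] y = refl
card-++ (false ∷ x) y = card-++ x y
card-++ (true ∷ x) y = cong suc (card-++ x y)

edges-⊆ : ∀ {n} b b′ (x x′ y y′ : Vec Bool n) → (edges b x y ⊆ᵇ edges b′ x′ y′) ≡ true →
  (not b ∨ b′) ≡ true × (x ⊆ᵇ x′) ≡ true × (y ⊆ᵇ y′) ≡ true
edges-⊆ b b′ x x′ y y′ sub =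
  let (p , q) = ∧-true sub in p , ∧-true (trans (sym (++-⊆ x x′ y y′)) q)

rk-thagomizer-monotone : ∀ {n} (E : SubsetF (suc (n ℕ.+ n))) → Monotone (mat E (rk (thagomizer n)))
rk-thagomizer-monotone {n} E S T S⊆T _ with toEdges {n} S | toEdges {n} T
... | mkEdges b x y | mkEdges b′ x′ y′ rewrite rk-thagomizer b x y | rk-thagomizer b′ x′ y′
  with edges-⊆ b b′ x x′ y y′ S⊆T
...   | b⊆ , x⊆ , y⊆ = ℕₚ.+-mono-≤ (bit-mono (joined b b′ b⊆)) (cov-mono x y x′ y′ x⊆ y⊆)
  where
  joined : ∀ b b′ → (not b ∨ b′) ≡ true → (b ∨ conn x y) ≡ true → (b′ ∨ conn x′ y′) ≡ true
  joined false b′ _ c rewrite conn-mono x y x′ y′ x⊆ y⊆ c = Boolₚ.∨-zeroʳ b′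
  joined true true _ _ = refl

cov-insert-new : ∀ {n} (x y : Vec Bool n) j → lookup x j ≡ false → lookup y j ≡ false →
  cov (x Vec.[ j ]≔ true) y ≡ suc (cov x y)
cov-insert-new (false ∷ x) (false ∷ y) zero _ _ = refl
cov-insert-new (a ∷ x) (b ∷ y) (suc j) p q =
  trans (cong (bit (a ∨ b) ℕ.+_) (cov-insert-new x y j p q)) (ℕₚ.+-suc (bit (a ∨ b)) (cov x y))

cov-insert-old : ∀ {n} (x y : Vec Bool n) j → lookup y j ≡ true → cov (x Vec.[ j ]≔ true) y ≡ cov x y
cov-insert-old (false ∷ x) (true ∷ y) zero _ = refl
cov-insert-old (true ∷ x) (true ∷ y) zero _ = refl
cov-insert-old (a ∷ x) (b ∷ y) (suc j) q = cong (bit (a ∨ b) ℕ.+_) (cov-insert-old x y j q)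

conn-insert : ∀ {n} (x y : Vec Bool n) j → lookup y j ≡ true → conn (x Vec.[ j ]≔ true) y ≡ true
conn-insert (a ∷ x) (true ∷ y) zero _ = refl
conn-insert (a ∷ x) (b ∷ y) (suc j) q rewrite conn-insert x y j q = Boolₚ.∨-zeroʳ (a ∧ b)

thagRank-comm : ∀ {n} b (x y : Vec Bool n) → thagRank b x y ≡ thagRank b y x
thagRank-comm b x y = cong₂ (λ c d → bit (b ∨ c) ℕ.+ d) (conn-comm x y) (cov-comm x y)

insertAB : ∀ {n} (x y : Vec Bool n) → rk (thagomizer n) (edges false x y ∪ₛ single zero) ≡ thagRank true x y
insertAB {n} x y = trans (cong (rk (thagomizer n)) (∪ₛ-single (edges false x y) zero)) (rk-thagomizer true x y)

insertA : ∀ {n} b (x y : Vec Bool n) j →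
  rk (thagomizer n) (edges b x y ∪ₛ single (suc (j ↑ˡ n))) ≡ thagRank b (x Vec.[ j ]≔ true) y
insertA {n} b x y j = trans
  (cong (rk (thagomizer n)) (trans (∪ₛ-single (edges b x y) (suc (j ↑ˡ n))) (cong (b ∷_) (Vecₚ.[]≔-++-↑ˡ x y j))))
  (rk-thagomizer b (x Vec.[ j ]≔ true) y)

-- The result is stated with the two sides exchanged, so that growth under insertion of Bj is an
-- instance of growth under insertion of Aj.
insertB : ∀ {n} b (x y : Vec Bool n) j →
  rk (thagomizer n) (edges b x y ∪ₛ single (suc (n ↑ʳ j))) ≡ thagRank b (y Vec.[ j ]≔ true) x
insertB {n} b x y j = trans
  (cong (rk (thagomizer n)) (trans (∪ₛ-single (edges b x y) (suc (n ↑ʳ j))) (cong (b ∷_) (Vecₚ.[]≔-++-↑ʳ x y j))))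
  (trans (rk-thagomizer b x (y Vec.[ j ]≔ true)) (thagRank-comm b x (y Vec.[ j ]≔ true)))

-- If Bj is present, then Aj joins A and B for the first time; otherwise it covers the new vertex j.
forest-grows : ∀ {n} (x y : Vec Bool n) j → conn x y ≡ false → lookup x j ≡ false →
  suc (thagRank false x y) ≤ thagRank false (x Vec.[ j ]≔ true) y
forest-grows x y j dis xj with lookup y j in yj
... | true rewrite dis | conn-insert x y j yj | cov-insert-old x y j yj = ℕₚ.≤-refl
... | false rewrite dis | cov-insert-new x y j xj yj = ℕₚ.m≤n+m _ (bit (conn (x Vec.[ j ]≔ true) y))

diagonal-grows : ∀ {n} (x : Vec Bool n) j → lookup x j ≡ false →
  suc (thagRank true x x) ≤ thagRank true (x Vec.[ j ]≔ true) x
diagonal-grows x j xj rewrite cov-insert-new x x j xj xj = ℕₚ.≤-refl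

grows⇒≢ : ∀ {a b a′ b′ : ℕ} → a′ ≡ a → b′ ≡ b → suc b ≤ a → a′ ≢ b′
grows⇒≢ refl refl lt refl = ℕₚ.<-irrefl refl lt

isClosed-thag : ∀ {n} (J : Vec Bool n) b (x y : Vec Bool n) →
  (b ≡ false → suc (thagRank false x y) ≤ thagRank true x y) →
  (∀ j → lookup x j ≡ false → suc (thagRank b x y) ≤ thagRank b (x Vec.[ j ]≔ true) y) →
  (∀ j → lookup y j ≡ false → suc (thagRank b x y) ≤ thagRank b (y Vec.[ j ]≔ true) x) →
  isClosed (mat (edges true J J) (rk (thagomizer n))) (edges b x y) ≡ true
isClosed-thag {n} J b x y growAB growA growB = isClosed-true (mat (edges true J J) (rk (thagomizer n))) (edges b x y) at
  where
  at : ∀ e → lookup (edges true J J) e ≡ true → lookup (edges b x y) e ≡ false →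
    rk (thagomizer n) (edges b x y ∪ₛ single e) ≢ rk (thagomizer n) (edges b x y)
  at zero _ refl = grows⇒≢ (insertAB x y) (rk-thagomizer false x y) (growAB refl)
  at (suc i) _ inF with splitAt n i in eq
  ... | inj₁ j with Finₚ.splitAt⁻¹-↑ˡ {i = i} eq
  ...   | refl = grows⇒≢ (insertA b x y j) (rk-thagomizer b x y) (growA j (trans (sym (Vecₚ.lookup-++ˡ x y j)) inF))
  at (suc i) _ inF | inj₂ j with Finₚ.splitAt⁻¹-↑ʳ {m = n} {i = i} eq
  ...   | refl = grows⇒≢ (insertB b x y j) (rk-thagomizer b x y) (growB j (trans (sym (Vecₚ.lookup-++ʳ x y j)) inF))

-- If some j carries both edges, AB lies in the closure. Otherwise AB, like every other missing
-- edge, raises the rank.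
isClosed-forest : ∀ {n} (J x y : Vec Bool n) →
  isClosed (mat (edges true J J) (rk (thagomizer n))) (edges false x y) ≡ not (conn x y)
isClosed-forest {n} J x y with conn x y in dis
... | true = isClosed-false (mat (edges true J J) (rk (thagomizer n))) (edges false x y) zero refl refl
  (trans (insertAB x y) (sym (trans (rk-thagomizer false x y) (cong (λ c → bit c ℕ.+ cov x y) dis))))
... | false = isClosed-thag J false x y
  (λ _ → ℕₚ.≤-reflexive (cong (λ c → suc (bit c ℕ.+ cov x y)) dis))
  (λ j → forest-grows x y j dis)
  (λ j yj → subst (λ r → suc r ≤ thagRank false (y Vec.[ j ]≔ true) x) (thagRank-comm false y x)
    (forest-grows y x j (trans (conn-comm y x) dis) yj))

eqv-true : ∀ {n} (x y : Vec Bool n) → eqv x y ≡ true → x ≡ y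
eqv-true [] [] _ = refl
eqv-true (false ∷ x) (false ∷ y) eq = cong (false ∷_) (eqv-true x y eq)
eqv-true (true ∷ x) (true ∷ y) eq = cong (true ∷_) (eqv-true x y eq)

eqv-false : ∀ {n} (x y : Vec Bool n) → eqv x y ≡ false →
  ∃ λ j → (lookup x j ≡ false × lookup y j ≡ true) ⊎ (lookup x j ≡ true × lookup y j ≡ false)
eqv-false [] [] ()
eqv-false (false ∷ x) (true ∷ y) _ = zero , inj₁ (refl , refl)
eqv-false (true ∷ x) (false ∷ y) _ = zero , inj₂ (refl , refl)
eqv-false (false ∷ x) (false ∷ y) eq = let (j , d) = eqv-false x y eq in suc j , d
eqv-false (true ∷ x) (true ∷ y) eq = let (j , d) = eqv-false x y eq in suc j , d

lookup-⊆ : ∀ {n} (x J : Vec Bool n) j → (x ⊆ᵇ J) ≡ true → lookup x j ≡ true → lookup J j ≡ true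
lookup-⊆ (true ∷ x) (true ∷ J) zero _ _ = refl
lookup-⊆ (false ∷ x) (c ∷ J) (suc j) sub eq = lookup-⊆ x J j sub eq
lookup-⊆ (true ∷ x) (true ∷ J) (suc j) sub eq = lookup-⊆ x J j sub eq

-- AB, Aj and Bj form a triangle, so a flat that contains AB contains both Aj and Bj or neither.
-- Where x and y differ, the missing edge of the triangle is the witness against closedness.
isClosed-diagonal : ∀ {n} (J x y : Vec Bool n) → (x ⊆ᵇ J) ≡ true → (y ⊆ᵇ J) ≡ true →
  isClosed (mat (edges true J J) (rk (thagomizer n))) (edges true x y) ≡ eqv x y
isClosed-diagonal {n} J x y x⊆J y⊆J with eqv x y in eq
... | true with eqv-true x y eq
...   | refl = isClosed-thag J true x x (λ ()) (diagonal-grows x) (diagonal-grows x)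
isClosed-diagonal {n} J x y x⊆J y⊆J | false with eqv-false x y eq
... | j , inj₁ (xj , yj) = isClosed-false (mat (edges true J J) (rk (thagomizer n))) (edges true x y) (suc (j ↑ˡ n))
  (trans (Vecₚ.lookup-++ˡ J J j) (lookup-⊆ y J j y⊆J yj)) (trans (Vecₚ.lookup-++ˡ x y j) xj)
  (trans (insertA true x y j) (trans (cong suc (cov-insert-old x y j yj)) (sym (rk-thagomizer true x y))))
... | j , inj₂ (xj , yj) = isClosed-false (mat (edges true J J) (rk (thagomizer n))) (edges true x y) (suc (n ↑ʳ j))
  (trans (Vecₚ.lookup-++ʳ J J j) (lookup-⊆ x J j x⊆J xj)) (trans (Vecₚ.lookup-++ʳ x y j) yj)
  (trans (insertB true x y j) (trans (cong suc (trans (cov-insert-old y x j xj) (cov-comm y x))) (sym (rk-thagomizer true x y))))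

-- Every cycle of K_{1,1,n} uses both edges at some j, and no j carries both here.
forest-Boolean : ∀ {n} (x y : Vec Bool n) → conn x y ≡ false → Boolean (mat (edges false x y) (rk (thagomizer n)))
forest-Boolean {n} x y dis S S⊆ with toEdges {n} S
... | mkEdges b u v with edges-⊆ b false u x v y S⊆
forest-Boolean {n} x y dis .(edges false u v) S⊆ | mkEdges false u v | _ , u⊆ , v⊆ =
  trans (rk-thagomizer false u v)
    (trans (cong₂ (λ c d → bit c ℕ.+ d) dis′ (cov-disjoint u v dis′)) (sym (card-++ u v)))
  where
  dis′ : conn u v ≡ false
  dis′ = Boolₚ.¬-not λ c → contradiction (trans (sym (conn-mono u v x y u⊆ v⊆ c)) dis) λ ()

edges-∪ : ∀ {n} b b′ (u v x y : Vec Bool n) → edges b u v ∪ₛ edges b′ x y ≡ edges (b ∨ b′) (u ∪ₛ x) (v ∪ₛ y)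
edges-∪ b b′ u v x y = cong ((b ∨ b′) ∷_) (Vecₚ.zipWith-++ _∨_ u v x y)

edges-∖ : ∀ {n} b b′ (u v x y : Vec Bool n) → edges b u v ∖ₛ edges b′ x y ≡ edges (b ∧ not b′) (u ∖ₛ x) (v ∖ₛ y)
edges-∖ b b′ u v x y = cong ((b ∧ not b′) ∷_) (Vecₚ.zipWith-++ (λ a b → a ∧ not b) u v x y)

-- The defining identity for T_J.

module Restriction {n : ℕ} (J : Vec Bool n) where

  M : Matroid (suc (n ℕ.+ n))
  M = mat (edges true J J) (rk (thagomizer n))

  monotone : Monotone M
  monotone = rk-thagomizer-monotone {n} (edges true J J)

  exponent : ∀ b b′ (u v x y : Vec Bool n) →
    rk M (edges b u v ∪ₛ edges b′ x y) ∸ rk M (edges b′ x y) ≡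
      thagRank (b ∨ b′) (u ∪ₛ x) (v ∪ₛ y) ∸ thagRank b′ x y
  exponent b b′ u v x y = cong₂ _∸_
    (trans (cong (rk M) (edges-∪ b b′ u v x y)) (rk-thagomizer (b ∨ b′) (u ∪ₛ x) (v ∪ₛ y)))
    (rk-thagomizer b′ x y)

  term : ∀ F k → SubsetF (suc (n ℕ.+ n)) → ℤ
  term F k S = mono (sign (card S)) (rk M (S ∪ₛ F) ∸ rk M F) k

  revχ-diagonal : ∀ (x : Vec Bool n) → (edges true x x ⊆ᵇ E M) ≡ true → revχ M (edges true x x) ≗ iter (card (J ∖ₛ x)) (linMul 1ℤ) 1P
  revχ-diagonal x F⊆E k = begin
    revχ M F k
      ≡⟨ revχ-sum M F monotone F⊆E k ⟩
    sumSub (E M ∖ₛ F) (term F k)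
      ≡⟨ cong (λ D → sumSub D (term F k)) (edges-∖ true true J J x x) ⟩
    sumSub ((J ∖ₛ x) ++ (J ∖ₛ x)) (λ S → term F k (false ∷ S))
      ≡⟨ sumSub-++ (J ∖ₛ x) (J ∖ₛ x) (λ S → term F k (false ∷ S)) ⟩
    sum2 (J ∖ₛ x) (J ∖ₛ x) (λ u v → term F k (edges false u v))
      ≡⟨ sum2-cong (J ∖ₛ x) (J ∖ₛ x) (λ u v → cong₂ (λ c d → mono (sign c) d k) (card-++ u v)
           (trans (exponent false true u v x x)
             (trans (cong (_∸ cov x x) (cov-∪ x x u v)) (ℕₚ.m+n∸m≡n (cov x x) (new x x u v))))) ⟩
    sum2 (J ∖ₛ x) (J ∖ₛ x) (λ u v → weight x x u v k)
      ≡⟨ sum2-weight J x k ⟩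
    iter (card (J ∖ₛ x)) (linMul 1ℤ) 1P k ∎
    where
    open ≡-Reasoning
    F = edges true x x

  revχ-forest : ∀ (x y : Vec Bool n) → conn x y ≡ false → (edges false x y ⊆ᵇ E M) ≡ true →
    revχ M (edges false x y) ≗ linMul 1ℤ (iter (uncovered J x y) (linMul (+ 2)) 1P)
  revχ-forest x y dis F⊆E k = begin
    revχ M F k
      ≡⟨ revχ-sum M F monotone F⊆E k ⟩
    sumSub (E M ∖ₛ F) (term F k)
      ≡⟨ cong (λ D → sumSub D (term F k)) (edges-∖ true false J J x y) ⟩
    sumSub (A ++ B) (λ S → term F k (false ∷ S)) ℤ.+ sumSub (A ++ B) (λ S → term F k (true ∷ S))
      ≡⟨ cong₂ ℤ._+_ (sumSub-++ A B (λ S → term F k (false ∷ S))) (sumSub-++ A B (λ S → term F k (true ∷ S))) ⟩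
    sum2 A B (λ u v → term F k (edges false u v)) ℤ.+ sum2 A B (λ u v → term F k (edges true u v))
      ≡⟨ sym (sum2-+ A B _ _) ⟩
    sum2 A B (λ u v → term F k (edges false u v) ℤ.+ term F k (edges true u v))
      ≡⟨ sum2-cong A B pair ⟩
    sum2 A B (λ u v → linMul 1ℤ (unconnected x y u v) k)
      ≡⟨ sum2-linMul A B 1ℤ (unconnected x y) k ⟩
    linMul 1ℤ (λ i → sum2 A B (λ u v → unconnected x y u v i)) k
      ≡⟨ linMul-cong 1ℤ (sum2-unconnected J x y dis) k ⟩
    linMul 1ℤ (iter (uncovered J x y) (linMul (+ 2)) 1P) k ∎
    where
    open ≡-Reasoning
    F = edges false x y
    A = J ∖ₛ x
    B = J ∖ₛ y
    -- Adding AB to S is a sign-reversing involution that preserves the rank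
    -- unless A and B are separated by S ∪ F.
    cases : ∀ b c e d k → (mono (sign c) ((bit b ℕ.+ (d ℕ.+ e)) ∸ d) k ℤ.+ mono (sign (suc c)) (suc (d ℕ.+ e) ∸ d) k) ≡
      linMul 1ℤ (λ i → if b then 0ℤ else mono (sign c) e i) k
    cases b c e d k rewrite ℕₚ.+-∸-assoc 1 (ℕₚ.m≤m+n d e) | mono-sign-suc c (d ℕ.+ e ∸ d) k | ℕₚ.m+n∸m≡n d e with b
    ... | false rewrite ℕₚ.m+n∸m≡n d e = cong (λ z → mono (sign c) e k ℤ.- z) (sym (ℤₚ.*-identityˡ (shift (mono (sign c) e) k)))
    ... | true rewrite ℕₚ.+-∸-assoc 1 (ℕₚ.m≤m+n d e) | ℕₚ.m+n∸m≡n d e | mono-suc (sign c) e k =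
      trans (ℤₚ.+-inverseʳ (shift (mono (sign c) e) k)) (zeros k)
      where
      zeros : ∀ k → 0ℤ ≡ linMul 1ℤ (λ _ → 0ℤ) k
      zeros zero = refl
      zeros (suc k) = refl
    pair : ∀ u v → term F k (edges false u v) ℤ.+ term F k (edges true u v) ≡ linMul 1ℤ (unconnected x y u v) k
    pair u v = trans
      (cong₂ ℤ._+_
        (cong₂ (λ c d → mono (sign c) d k) (card-++ u v)
          (trans (exponent false false u v x y) (cong₂ (λ r s → (bit (conn (u ∪ₛ x) (v ∪ₛ y)) ℕ.+ r) ∸ s) (cov-∪ x y u v) F-rank)))
        (cong₂ (λ c d → mono (sign (suc c)) d k) (card-++ u v)
          (trans (exponent true false u v x y) (cong₂ (λ r s → suc r ∸ s) (cov-∪ x y u v) F-rank))))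
      (cases (conn (u ∪ₛ x) (v ∪ₛ y)) (card u ℕ.+ card v) (new x y u v) (cov x y) k)
      where
      F-rank : thagRank false x y ≡ cov x y
      F-rank = cong (λ c → bit c ℕ.+ cov x y) dis

  -- The value is only meaningful on flats; for those containing AB the A-edges
  -- determine the flat.
  Q : SubsetF (suc (n ℕ.+ n)) → Poly
  Q (b ∷ S) = if b then motzkin (card (Vec.take n S)) else 1P

  Q-diagonal : ∀ (x y : Vec Bool n) → Q (edges true x y) ≗ motzkin (card x)
  Q-diagonal x y k = cong (λ z → motzkin (card z) k) (take-++ x y)
    where
    take-++ : ∀ {m} (x : SubsetF m) {l} (y : SubsetF l) → Vec.take m (x ++ y) ≡ x
    take-++ [] y = refl
    take-++ (a ∷ x) y = cong (a ∷_) (take-++ x y)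

  flatTerm : ℕ → SubsetF (suc (n ℕ.+ n)) → ℤ
  flatTerm k F = if isClosed M F then sign (rk M F) ℤ.* (Q F ⊛ revχ M F) k else 0ℤ

  ⊆-E : ∀ b (x y : Vec Bool n) → (x ⊆ᵇ J) ≡ true → (y ⊆ᵇ J) ≡ true → (edges b x y ⊆ᵇ E M) ≡ true
  ⊆-E b x y x⊆J y⊆J = cong₂ _∧_ (Boolₚ.∨-zeroʳ (not b)) (trans (++-⊆ x J y J) (cong₂ _∧_ x⊆J y⊆J))

  flatTerm-forest : ∀ k (x y : Vec Bool n) → (x ⊆ᵇ J) ≡ true → (y ⊆ᵇ J) ≡ true →
    flatTerm k (edges false x y) ≡
      (if not (conn x y) then sign (cov x y) ℤ.* linMul 1ℤ (iter (uncovered J x y) (linMul (+ 2)) 1P) k else 0ℤ)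
  flatTerm-forest k x y x⊆J y⊆J = byConn (conn x y) refl
    where
    byConn : ∀ c → conn x y ≡ c → flatTerm k (edges false x y) ≡
      (if not c then sign (cov x y) ℤ.* linMul 1ℤ (iter (uncovered J x y) (linMul (+ 2)) 1P) k else 0ℤ)
    byConn true eq = if-false (trans (isClosed-forest J x y) (cong not eq))
    byConn false eq = trans (if-true (trans (isClosed-forest J x y) (cong not eq)))
      (cong₂ (λ d z → sign d ℤ.* z)
        (trans (rk-thagomizer false x y) (cong (λ c → bit c ℕ.+ cov x y) eq))
        (trans (⊛-cong {p = 1P} (λ _ → refl) (revχ-forest x y eq (⊆-E false x y x⊆J y⊆J)) k)
          (⊛-1P-linMul-iter (uncovered J x y) k)))

  -- The minus sign comes from AB, which makes the rank of F one more than `card x`.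
  flatTerm-diagonal : ∀ k (x y : Vec Bool n) → (x ⊆ᵇ J) ≡ true → (y ⊆ᵇ J) ≡ true →
    flatTerm k (edges true x y) ≡
      ℤ.- (if eqv x y then sign (card x) ℤ.* iter (card (J ∖ₛ x)) (linMul 1ℤ) (motzkin (card x)) k else 0ℤ)
  flatTerm-diagonal k x y x⊆J y⊆J = byEq (eqv x y) refl
    where
    byEq : ∀ c → eqv x y ≡ c → flatTerm k (edges true x y) ≡
      ℤ.- (if c then sign (card x) ℤ.* iter (card (J ∖ₛ x)) (linMul 1ℤ) (motzkin (card x)) k else 0ℤ)
    byEq false eq = if-false (trans (isClosed-diagonal J x y x⊆J y⊆J) eq)
    byEq true eq with eqv-true x y eq
    ... | refl = trans (if-true (trans (isClosed-diagonal J x x x⊆J x⊆J) eq))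
      (trans
        (cong₂ (λ d z → sign d ℤ.* z)
          (trans (rk-thagomizer true x x) (cong suc (cov-self x)))
          (trans (⊛-cong {p = Q (edges true x x)} (Q-diagonal x x)
                    (revχ-diagonal x (⊆-E true x x x⊆J x⊆J)) k)
            (⊛-iter-linMul 1ℤ (card (J ∖ₛ x)) (motzkin (card x)) k)))
        (sym (ℤₚ.neg-distribˡ-* (sign (card x)) _)))

  total : ∀ k → 2 ℕ.* k ≤ card J → sumSub (E M) (flatTerm k) ≡ 0ℤ
  total k le = begin
    sumSub (J ++ J) (λ S → flatTerm k (false ∷ S)) ℤ.+ sumSub (J ++ J) (λ S → flatTerm k (true ∷ S))
      ≡⟨ cong₂ ℤ._+_ (sumSub-++ J J (λ S → flatTerm k (false ∷ S))) (sumSub-++ J J (λ S → flatTerm k (true ∷ S))) ⟩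
    sum2 J J (λ x y → flatTerm k (edges false x y)) ℤ.+ sum2 J J (λ x y → flatTerm k (edges true x y))
      ≡⟨ cong₂ ℤ._+_
           (trans (sum2-cong-⊆ J J (λ x y x⊆ y⊆ → trans (flatTerm-forest k x y x⊆ y⊆)
                (if-*-linMul (not (conn x y)) (sign (cov x y)) 1ℤ (iter (uncovered J x y) (linMul (+ 2)) 1P) k)))
             (trans (sum2-linMul J J 1ℤ _ k) (linMul-cong 1ℤ (sum2-forests J) k)))
           (trans (sum2-cong-⊆ J J (flatTerm-diagonal k))
             (trans (sum2-neg J J _) (cong ℤ.-_ (sum2-diagonal J motzkin k)))) ⟩
    linMul 1ℤ (iter (card J) negMul 1P) k ℤ.- binT (card J) motzkin k
      ≡⟨ ℤₚ.+-comm (linMul 1ℤ (iter (card J) negMul 1P) k) _ ⟩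
    ℤ.- binT (card J) motzkin k ℤ.+ linMul 1ℤ (iter (card J) negMul 1P) k
      ≡⟨ kl-identity (card J) k le ⟩
    0ℤ ∎
    where open ≡-Reasoning

-- Induction on J and the conclusion.

card-mono-< : ∀ {m} (S T : SubsetF m) → (S ⊆ᵇ T) ≡ true → S ≢ T → card S < card T
card-mono-< [] [] _ S≢T = contradiction refl S≢T
card-mono-< (false ∷ S) (false ∷ T) sub S≢T = card-mono-< S T sub (S≢T ∘ cong (false ∷_))
card-mono-< (false ∷ S) (true ∷ T) sub S≢T = s≤s (card-mono S T sub)
card-mono-< (true ∷ S) (true ∷ T) sub S≢T = s≤s (card-mono-< S T sub (S≢T ∘ cong (true ∷_)))

-- A proper flat is either a forest, hence Boolean with polynomial 1, or T_x with x properly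
-- contained in J. The smaller cardinality of x keeps the bound on the fuel.
invKLfuel-thagomizer : ∀ {n} f (J : Vec Bool n) → card J < f →
  invKLfuel f (mat (edges true J J) (rk (thagomizer n))) ≗ motzkin (card J)
invKLfuel-thagomizer {n} (suc f) J (s≤s J≤f) k = trans
  (invKLfuel-unique f M (card J) Q (trans (rk-thagomizer true J J) (cong suc (cov-self J)))
    proper (isClosed-E M) (revχ-E M monotone)
    (λ i lt → trans (Q-diagonal J J i) (motzkin-degree (card J) i lt))
    (λ i lt → total i (ℕₚ.≤-pred lt)) k)
  (Q-diagonal J J k)
  where
  open Restriction {n} J
  proper : ∀ F → (F ⊆ᵇ E M) ≡ true → isClosed M F ≡ true → (F ==ₛ E M) ≡ false → invKLfuel f (restrict M F) ≗ Q F
  proper F F⊆E clF F≠E with toEdges {n} F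
  ... | mkEdges false x y = invKLfuel-Boolean f (mat (edges false x y) (rk (thagomizer n)))
    (forest-Boolean x y (Boolₚ.not-injective (trans (sym (isClosed-forest J x y)) clF)))
  ... | mkEdges true x y with edges-⊆ true true x J y J F⊆E
  ...   | _ , x⊆J , y⊆J with eqv-true x y (trans (sym (isClosed-diagonal J x y x⊆J y⊆J)) clF)
  ...     | refl = λ i → trans
    (invKLfuel-thagomizer f x (ℕₚ.<-≤-trans (card-mono-< x J x⊆J x≢J) J≤f) i)
    (sym (Q-diagonal x x i))
    where
    x≢J : x ≢ J
    x≢J refl = contradiction (trans (sym (==ₛ-refl (edges true x x))) F≠E) λ ()

tabulate-true-++ : ∀ m n → tabulate {n = m ℕ.+ n} (λ _ → true) ≡ tabulate {n = m} (λ _ → true) ++ tabulate {n = n} (λ _ → true)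
tabulate-true-++ zero n = refl
tabulate-true-++ (suc m) n = cong (true ∷_) (tabulate-true-++ m n)

card-true : ∀ n → card (tabulate {n = n} (λ _ → true)) ≡ n
card-true zero = refl
card-true (suc n) = cong suc (card-true n)

invKL-thagomizer : ∀ n → invKL (thagomizer n) ≗ motzkin n
invKL-thagomizer n k = begin
  invKLfuel (suc (rank (thagomizer n))) (thagomizer n) k
    ≡⟨ cong (λ X → invKLfuel (suc (rk (thagomizer n) X)) (mat X (rk (thagomizer n))) k) (cong (true ∷_) (tabulate-true-++ n n)) ⟩
  invKLfuel (suc (rk (thagomizer n) (edges true J J))) (mat (edges true J J) (rk (thagomizer n))) k
    -- The rank is `card J` + 1, so the fuel `card J` + 2 exceeds `card J`.
    ≡⟨ invKLfuel-thagomizer _ J (subst (card J <_)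
         (cong suc (sym (trans (rk-thagomizer true J J) (cong suc (cov-self J))))) (s≤s (ℕₚ.n≤1+n (card J)))) k ⟩
  motzkin (card J) k
    ≡⟨ cong (λ m → motzkin m k) (card-true n) ⟩
  motzkin n k ∎
  where
  open ≡-Reasoning
  J = tabulate {n = n} (λ _ → true)

theorem1p2 : (n k : ℕ) → invKL (thagomizer n) k / 1 ≡ thagCoeff n k
theorem1p2 n k = trans (cong (_/ 1) (invKL-thagomizer n k)) (motzkin-thagCoeff n k)
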